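{- Assume $\diamondsuit$. Then for every function $f:\mathbb{N}\to\mathbb{N}$ there is a Hajnal–Máté graph $G$ such that $|G|=\chi(G)=\aleph_1$ and, for every natural number $k\ge 3$, $f_G(k)\ge f(k)$; that is, every subgraph of $G$ with fewer than $f(k)$ vertices has chromatic number less than $k$.
   Context: $\diamondsuit$ is the assertion that there is a sequence $\langle A_\alpha\mid\alpha<\omega_1\rangle$ with $A_\alpha\subseteq\alpha$ for each $\alpha$ such that for every $A\subseteq\omega_1$ the set $\{\alpha<\omega_1\mid A\cap\alpha=A_\alpha\}$ is stationary. A graph $G=(\omega_1,E)$ is a Hajnal–Máté graph if for every $\beta<\omega_1$ the set $\{\alpha<\beta\mid \{\alpha,\beta\}\in E\}$ is either finite or a set of order type $\omega$ converging to $\beta$ (i.e., cofinal in $\beta$). Graphs are simple undirected graphs. For a graph $G$ with infinite chromatic number and $k\in\mathbb{N}$, $f_G(k)$ is the least natural number $m$ such that $G$ has a subgraph with $m$ vertices and chromatic number at least $k$. -}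

module Defs where

open import Axiom.ExcludedMiddle using (ExcludedMiddle)
open import Axiom.Extensionality.Propositional using (Extensionality)
open import Data.Fin.Base using (Fin)
open import Data.List.Base using (List)
open import Data.List.Membership.Propositional using (_∈_)
open import Data.Nat.Base as ℕ using (ℕ)
open import Data.Product.Base using (Σ-syntax; ∃-syntax; _×_)
open import Data.Sum.Base using (_⊎_)
open import Function.Bundles using (_↣_; _⤖_; _⇔_; module Injection)
open import Induction.WellFounded using (WellFounded)
open import Level using (0ℓ; Setω)
open import Relation.Binary.Core using (Rel)
open import Relation.Binary.Definitions using (Symmetric; Irreflexive)
open import Relation.Binary.PropositionalEquality.Core using (_≡_; _≢_)
open import Relation.Binary.Structures using (IsStrictTotalOrder)
open import Relation.Nullary.Negation.Core using (¬_)
open import Relation.Unary using (Pred; U; _∩_; _⊆_; _≐_; _≬_)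

-- The classical metatheory (ZFC).  As excluded middle is assumed for all
-- types, and existence is expressed by Σ, it also gives the axiom of choice:
-- if every B x satisfies ¬ ¬ B x, then deciding each B x yields ∀ x → B x.
record Classical : Setω where
  field
    excludedMiddle : ∀ {ℓ} → ExcludedMiddle ℓ
    extensionality : ∀ {a b} → Extensionality a b

module _ {A : Set} where

  Finite : Pred A 0ℓ → Set
  Finite P = ∃[ xs ] (∀ x → P x → x ∈ xs)

  -- Finite sets count as countable.
  Countable : Pred A 0ℓ → Set
  Countable P =
    Σ[ e ∈ (A → ℕ) ] (∀ {x y} → P x → P y → e x ≡ e y → x ≡ y)

-- A presentation of ω₁: it is, up to isomorphism, the only uncountable
-- well-order all of whose proper initial segments are countable.
record Omega₁ : Set₁ where
  infix 4 _<_
  field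
    Carrier            : Set
    _<_                : Rel Carrier 0ℓ
    isStrictTotalOrder : IsStrictTotalOrder _≡_ _<_
    wellFounded        : WellFounded _<_
    uncountable        : ¬ Countable {Carrier} U
    countableSegments  : ∀ α → Countable (_< α)

module _ (ω₁ : Omega₁) where
  open Omega₁ ω₁

  UnboundedIn : Carrier → Pred Carrier 0ℓ → Set
  UnboundedIn δ P = ∀ γ → γ < δ → ∃[ α ] (P α × γ < α × α < δ)

  Unbounded : Pred Carrier 0ℓ → Set
  Unbounded P = ∀ γ → ∃[ α ] (P α × γ < α)

  -- Only limit ordinals δ are concerned: the first premise excludes 0, and
  -- no set is UnboundedIn a successor, the inequalities there being strict.
  Closed : Pred Carrier 0ℓ → Set
  Closed P = ∀ δ → (∃[ γ ] γ < δ) → UnboundedIn δ P → P δ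

  Stationary : Pred Carrier 0ℓ → Set₁
  Stationary S = ∀ C → Closed C → Unbounded C → S ≬ C

  Diamond : Set₁
  Diamond =
    Σ[ A ∈ (Carrier → Pred Carrier 0ℓ) ]
      (∀ α → A α ⊆ (_< α)) ×
      (∀ (X : Pred Carrier 0ℓ) → Stationary (λ α → (X ∩ (_< α)) ≐ A α))

  -- The enumeration s is an order isomorphism from ℕ onto P.
  OrderTypeω : Pred Carrier 0ℓ → Set
  OrderTypeω P =
    Σ[ s ∈ (ℕ → Carrier) ]
      (∀ {m n} → m ℕ.< n → s m < s n) ×
      (∀ α → P α ⇔ (∃[ n ] s n ≡ α))

record Graph (V : Set) : Set₁ where
  field
    Edge   : Rel V 0ℓ
    sym    : Symmetric Edge
    irrefl : Irreflexive _≡_ Edge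

open Graph

-- H is a subgraph of G up to isomorphism, not necessarily induced.
record _⊑_ {V W : Set} (H : Graph V) (G : Graph W) : Set where
  field
    vertices : V ↣ W
    edges    : ∀ {x y} → Edge H x y →
               Edge G (Injection.to vertices x) (Injection.to vertices y)

-- Below, a set κ stands for the cardinal ∣κ∣.
module _ {V : Set} where

  HasOrder : Graph V → Set → Set
  HasOrder _ κ = V ⤖ κ

  Colouring : Graph V → Set → Set
  Colouring G C = Σ[ c ∈ (V → C) ] (∀ {x y} → Edge G x y → c x ≢ c y)

  ChromaticNumber≥ : Graph V → Set → Set₁
  ChromaticNumber≥ G κ = ∀ (C : Set) → Colouring G C → κ ↣ C

  HasChromaticNumber : Graph V → Set → Set₁
  HasChromaticNumber G κ = Colouring G κ × ChromaticNumber≥ G κ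

module _ {V : Set} where

  HasSubgraph : Graph V → ℕ → ℕ → Set₁
  HasSubgraph G k m =
    Σ[ W ∈ Set ] Σ[ H ∈ Graph W ]
      H ⊑ G × HasOrder H (Fin m) × ChromaticNumber≥ H (Fin k)

  -- f_G(k) = m
  Isf : Graph V → ℕ → ℕ → Set₁
  Isf G k m = HasSubgraph G k m × (∀ n → HasSubgraph G k n → m ℕ.≤ n)

module _ (ω₁ : Omega₁) where
  open Omega₁ ω₁

  HajnalMáté : Graph Carrier → Set
  HajnalMáté G = ∀ β →
    let N = λ α → α < β × Edge G α β
    in Finite N ⊎ (OrderTypeω ω₁ N × UnboundedIn ω₁ β N)

{-# OPTIONS --safe #-}

-- Let ◇ guess, at δ, a colouring c_δ : δ → ℕ together with a label X_δ consisting of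
-- ω finite blocks of ordinals.  The m-th neighbour of δ is some α < δ with c_δ(α) = m
-- such that, for all j ≤ m, the j-th blocks of X_α and X_δ interleave with shift F(j);
-- the neighbours are chosen increasing and cofinal in δ.
--
-- Edges of index < n form n forests, so they are 2ⁿ-colourable.  An edge of index ≥ n
-- moves the position of a fixed ordinal in the n-th block by s or s + 1, s = F(n).
-- Modulo 2s + 1 this maps every component with at most s vertices to an odd cycle that
-- is too long to be covered, so these edges are 2-colourable on at most s vertices.
-- Hence at most F(n) vertices need at most 2ⁿ⁺¹ colours.
--
-- Given c : ω₁ → ℕ, every label X is guessed together with c on a stationary set,
-- hence on a stationary set of some colour m = m(X).  For some m the labels with
-- m(X) = m are so rich that two of them, X and Y, interleave on the blocks 0, …, m.
-- Some δ of colour m labelled Y is a limit of vertices of colour m labelled X, so its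
-- m-th neighbour exists, and that edge is monochromatic.
module Submission where

open import Data.Fin.Base using (Fin)
open import Data.Nat.Base using (ℕ; _≤_; _<_)
open import Data.Product.Base using (Σ-syntax; ∃-syntax; _×_)
open import Defs
import Data.Fin.Base as Fin
import Data.Fin.Properties as Fin
import Data.Nat.Base as ℕ
import Data.Nat.Properties as ℕ
open import Data.Fin.Base using (toℕ; inject≤; combine)
open import Data.List.Base using (List; []; _∷_; length; tabulate; applyUpTo)
open import Data.List.Membership.Propositional using (_∈_)
open import Data.List.Membership.Propositional.Properties using (∈-tabulate⁺; ∈-applyUpTo⁺)
open import Data.List.Properties using (length-tabulate)
open import Data.List.Relation.Unary.Any using (here; there)
open import Data.Nat.Base using (zero; suc; _+_; _*_; _^_; z≤n; s≤s; NonZero)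
open import Data.Nat.DivMod
open import Data.Nat.Divisibility using (_∣_; m%n≡0⇒n∣m; ∣m+n∣m⇒∣n; >⇒∤)
open import Data.Nat.Induction using (<-wellFounded)
open import Data.Product.Base using (∃; _,_; proj₁; proj₂)
open import Data.Sum.Base using (_⊎_; inj₁; inj₂)
open import Data.Unit.Base using (⊤; tt)
open import Function.Base using (_∘_; id)
open import Function.Bundles using (_↣_; _⤖_; mk↣; mk⇔; module Injection; module Bijection)
open import Function.Construct.Identity using (⤖-id)
open import Function.Definitions using (Injective)
open import Induction.WellFounded using (WellFounded; Acc; acc; module All; module FixPoint)
open import Level using (0ℓ)
open import Relation.Binary.Core using (Rel)
open import Relation.Binary.Definitions using (Symmetric; tri<; tri≈; tri>)
open import Relation.Binary.PropositionalEquality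
open import Relation.Binary.Structures using (IsStrictTotalOrder)
open import Relation.Nullary.Decidable.Core using (yes; no)
open import Relation.Nullary.Negation.Core using (¬_; contradiction)
open import Relation.Unary using (Pred; Decidable; U; _∩_; _≐_)

-- Pairing and crossing in the natural numbers

abstract
  -- Injective but not surjective: the pairs with sum `n` are coded between `n * n` and `n * n + n`,
  -- and these intervals are disjoint.
  pair : ℕ → ℕ → ℕ
  pair i j = (i + j) * (i + j) + i

  pair-< : ∀ i j k l → i + j < k + l → pair i j < pair k l
  pair-< i j k l lt = begin-strict
    (i + j) * (i + j) + i         ≤⟨ ℕ.+-monoʳ-≤ ((i + j) * (i + j)) (ℕ.m≤m+n i j) ⟩
    (i + j) * (i + j) + (i + j)   ≡⟨ ℕ.+-comm ((i + j) * (i + j)) (i + j) ⟩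
    suc (i + j) * (i + j)         <⟨ ℕ.*-monoʳ-< (suc (i + j)) (ℕ.n<1+n (i + j)) ⟩
    suc (i + j) * suc (i + j)     ≤⟨ ℕ.*-mono-≤ lt lt ⟩
    (k + l) * (k + l)             ≤⟨ ℕ.m≤m+n _ k ⟩
    (k + l) * (k + l) + k         ∎
    where open ℕ.≤-Reasoning

  pair-injective : ∀ i j k l → pair i j ≡ pair k l → i ≡ k × j ≡ l
  pair-injective i j k l eq with ℕ.<-cmp (i + j) (k + l)
  ... | tri< lt _ _ = contradiction eq (ℕ.<⇒≢ (pair-< i j k l lt))
  ... | tri> _ _ gt = contradiction (sym eq) (ℕ.<⇒≢ (pair-< k l i j gt))
  ... | tri≈ _ same _ = i≡k , ℕ.+-cancelˡ-≡ i j l (trans same (cong (_+ l) (sym i≡k)))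
    where
    i≡k : i ≡ k
    i≡k = ℕ.+-cancelˡ-≡ ((i + j) * (i + j)) i k (trans eq (cong (λ n → n * n + k) (sym same)))

crossing : {P : Pred ℕ 0ℓ} → Decidable P → ¬ P 0 → ∀ {n} → P n →
           ∃[ k ] (k < n × ¬ P k × P (suc k))
crossing P? ¬P0 {zero}  Pn = contradiction Pn ¬P0
crossing P? ¬P0 {suc n} Psn with P? n
... | yes Pn = let k , k<n , rest = crossing P? ¬P0 Pn in k , ℕ.m<n⇒m<1+n k<n , rest
... | no ¬Pn = n , ℕ.n<1+n n , ¬Pn , Psn

-- Residues modulo an odd number

arc : ℕ → ℕ → Fin 2
arc s r with r ℕ.≤? s
... | yes _ = Fin.zero
... | no  _ = Fin.suc Fin.zero

arc-≤ : ∀ {s r} → r ≤ s → arc s r ≡ Fin.zero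
arc-≤ {s} {r} r≤s with r ℕ.≤? s
... | yes _   = refl
... | no  r≰s = contradiction r≤s r≰s

arc-> : ∀ {s r} → s < r → arc s r ≡ Fin.suc Fin.zero
arc-> {s} {r} s<r with r ℕ.≤? s
... | yes r≤s = contradiction r≤s (ℕ.<⇒≱ s<r)
... | no  _   = refl

+-%ˡ : ∀ p e q .{{_ : NonZero q}} → (p + e) % q ≡ (p % q + e) % q
+-%ˡ p e q = begin
  (p + e) % q                    ≡⟨ cong (λ n → (n + e) % q) (m≡m%n+[m/n]*n p q) ⟩
  (p % q + p / q * q + e) % q    ≡⟨ cong (_% q) (ℕ.+-assoc (p % q) _ e) ⟩
  (p % q + (p / q * q + e)) % q  ≡⟨ cong (λ n → (p % q + n) % q) (ℕ.+-comm _ e) ⟩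
  (p % q + (e + p / q * q)) % q  ≡⟨ cong (_% q) (ℕ.+-assoc (p % q) e _) ⟨
  (p % q + e + p / q * q) % q    ≡⟨ [m+kn]%n≡m%n (p % q + e) (p / q) q ⟩
  (p % q + e) % q                ∎
  where open ≡-Reasoning

+-%-small : ∀ p e q .{{_ : NonZero q}} → p % q + e < q → (p + e) % q ≡ p % q + e
+-%-small p e q small = trans (+-%ˡ p e q) (m<n⇒m%n≡m small)

+-%-wrap : ∀ p e q .{{_ : NonZero q}} {c} → p % q + e ≡ c + q → c < q → (p + e) % q ≡ c
+-%-wrap p e q {c} eq c<q =
  trans (+-%ˡ p e q) (trans (cong (_% q) eq) (trans ([m+n]%n≡m%n c q) (m<n⇒m%n≡m c<q)))

-- Modulo 2s + 1 the steps s and s + 1 = −s generate a cycle of length 2s + 1.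
-- It becomes a path when the residue 0 is deleted, and arc s 2-colours this path.
arc-step : ∀ s p p′ → p % suc (s + s) ≢ 0 → p′ % suc (s + s) ≢ 0 →
           p′ ≡ p + s ⊎ p′ ≡ p + suc s →
           arc s (p % suc (s + s)) ≢ arc s (p′ % suc (s + s))
arc-step s p p′ p≢0 p′≢0 step with ℕ.≤-<-connex (p % suc (s + s)) s
... | inj₁ r≤s = λ eq →
  contradiction (trans (sym (arc-≤ r≤s)) (trans eq (arc-> (high step)))) λ ()
  where
  q : ℕ
  q = suc (s + s)
  high : p′ ≡ p + s ⊎ p′ ≡ p + suc s → s < p′ % q
  high (inj₁ refl) = subst (s <_) (sym (+-%-small p s q (s≤s (ℕ.+-monoˡ-≤ s r≤s))))
                       (ℕ.+-monoˡ-≤ s (ℕ.n≢0⇒n>0 p≢0))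
  -- The residue `s` would be sent to `0`, which `p′≢0` excludes.
  high (inj₂ refl) with ℕ.m≤n⇒m<n∨m≡n r≤s
  ... | inj₂ r≡s = contradiction
      (+-%-wrap p (suc s) q (trans (cong (_+ suc s) r≡s) (ℕ.+-suc s s)) (s≤s z≤n)) p′≢0
  ... | inj₁ r<s = subst (s <_) (sym (+-%-small p (suc s) q
                       (subst (_< q) (sym (ℕ.+-suc (p % q) s)) (s≤s (ℕ.+-monoˡ-≤ s r<s)))))
                     (ℕ.m≤n+m (suc s) (p % q))
... | inj₂ s<r = λ eq →
  contradiction (trans (sym (arc-≤ (low step))) (trans (sym eq) (arc-> s<r))) λ ()
  where
  q r : ℕ
  q = suc (s + s)
  r = p % q
  -- Adding `s` to `r` wraps around to `r ∸ suc s`, and adding `suc s` wraps around to the residue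
  -- after it.
  c≤s : r ℕ.∸ suc s ≤ s
  c≤s = ℕ.≤-trans (ℕ.∸-monoˡ-≤ (suc s) (ℕ.<⇒≤ (m%n<n p q))) (ℕ.≤-reflexive (ℕ.m+n∸m≡n s s))
  split : r ≡ r ℕ.∸ suc s + suc s
  split = sym (ℕ.m∸n+n≡m s<r)
  low : p′ ≡ p + s ⊎ p′ ≡ p + suc s → p′ % q ≤ s
  low (inj₁ refl) = subst (_≤ s) (sym (+-%-wrap p s q
      (trans (cong (_+ s) split) (ℕ.+-assoc (r ℕ.∸ suc s) (suc s) s))
      (s≤s (ℕ.≤-trans c≤s (ℕ.m≤m+n s s))))) c≤s
  low (inj₂ refl) = subst (_≤ s) (sym (+-%-wrap p (suc s) q
      (trans (cong (_+ suc s) split)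
        (trans (ℕ.+-assoc (r ℕ.∸ suc s) (suc s) (suc s))
          (trans (cong (r ℕ.∸ suc s +_) (cong suc (ℕ.+-suc s s)))
            (ℕ.+-suc (r ℕ.∸ suc s) (suc (s + s))))))
      (s≤s (ℕ.≤-trans c<s (ℕ.m≤m+n s s))))) c<s
    where
    c<s : suc (r ℕ.∸ suc s) ≤ s
    c<s = ℕ.+-cancelʳ-≤ (suc s) _ s (subst₂ _≤_ (cong suc split) (sym (ℕ.+-suc s s)) (m%n<n p q))

-- Otherwise `q` would divide `t′ ∸ t`, which is positive and less than `q`.
%-shift-unique : ∀ p q .{{_ : NonZero q}} {t t′} → t′ < q →
                 (p + t) % q ≡ 0 → (p + t′) % q ≡ 0 → ¬ t < t′
%-shift-unique p q {t} {t′} t′<q z z′ t<t′ =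
  >⇒∤ {{ℕ.>-nonZero (ℕ.m<n⇒0<n∸m t<t′)}} (ℕ.≤-<-trans (ℕ.m∸n≤m t′ t) t′<q)
  (∣m+n∣m⇒∣n
    (subst (q ∣_)
      (trans (cong (p +_) (sym (ℕ.m+[n∸m]≡n (ℕ.<⇒≤ t<t′)))) (sym (ℕ.+-assoc p t _)))
      (m%n≡0⇒n∣m (p + t′) q z′))
    (m%n≡0⇒n∣m (p + t) q z))

-- As in the Floyd–Warshall algorithm, the walks have their inner vertices in the given
-- list; this bounds their length by 2 ^ length.
data Reach {V : Set} (E : Rel V 0ℓ) : List V → Rel V 0ℓ where
  edge : ∀ {u v} → E u v → Reach E [] u v
  skip : ∀ {w ws u v} → Reach E ws u v → Reach E (w ∷ ws) u v
  join : ∀ {w ws u v} → Reach E ws u w → Reach E ws w v → Reach E (w ∷ ws) u v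

module _ {V : Set} {E : Rel V 0ℓ} where

  Reach-edge : ∀ ws {u v} → E u v → Reach E ws u v
  Reach-edge []       e = edge e
  Reach-edge (_ ∷ ws) e = skip (Reach-edge ws e)

  Reach-sym : Symmetric E → ∀ {ws} → Symmetric (Reach E ws)
  Reach-sym E-sym (edge e)   = edge (E-sym e)
  Reach-sym E-sym (skip r)   = skip (Reach-sym E-sym r)
  Reach-sym E-sym (join r t) = join (Reach-sym E-sym t) (Reach-sym E-sym r)

  -- The list does not grow: if both walks pass through its head `w`, the closed detour from `w` via
  -- `x` back to `w` is cut out.
  Reach-trans : ∀ {ws x u v} → x ∈ ws → Reach E ws u x → Reach E ws x v → Reach E ws u v
  Reach-trans _            (join r _) (join _ t)  = join r t
  Reach-trans (here refl)  (skip r)   (skip t)    = join r t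
  Reach-trans (here refl)  (skip r)   (join _ t)  = join r t
  Reach-trans (here refl)  (join r _) (skip t)    = join r t
  Reach-trans (there x∈ws) (skip r)   (skip t)    = skip (Reach-trans x∈ws r t)
  Reach-trans (there x∈ws) (skip r)   (join t t′) = join (Reach-trans x∈ws r t) t′
  Reach-trans (there x∈ws) (join r r′) (skip t)   = join r (Reach-trans x∈ws r′ t)

  -- By induction on the list, a walk has at most `2 ^ length ws` edges, each of which costs `a`.
  Reach-near : ∀ {Near : ℕ → Rel V 0ℓ} →
    (∀ {a b u v w} → Near a u v → Near b v w → Near (a + b) u w) →
    (∀ {a b u v} → a ≤ b → Near a u v → Near b u v) →
    ∀ {a} → (∀ {u v} → E u v → Near a u v) →
    ∀ {ws u v} → Reach E ws u v → Near (2 ^ length ws * a) u v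
  Reach-near {Near} compose weaken {a} base = go
    where
    double : ∀ n {u v} → Near (2 ^ n * a + 2 ^ n * a) u v → Near (2 ^ suc n * a) u v
    double n {u} {v} = subst (λ b → Near b u v)
      (sym (trans (cong (λ b → (2 ^ n + b) * a) (ℕ.+-identityʳ (2 ^ n)))
        (ℕ.*-distribʳ-+ a (2 ^ n) (2 ^ n))))
    go : ∀ {ws u v} → Reach E ws u v → Near (2 ^ length ws * a) u v
    go {u = u} {v} (edge e) = subst (λ b → Near b u v) (sym (ℕ.+-identityʳ a)) (base e)
    go {_ ∷ ws} (skip r)    = double (length ws) (weaken (ℕ.m≤m+n _ _) (go r))
    go {_ ∷ ws} (join r t)  = double (length ws) (compose (go r) (go t))

-- Sequences, sums and powers of two

infixr 5 _∷ₛ_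

_∷ₛ_ : {A : Set} → A → (ℕ → A) → ℕ → A
(a ∷ₛ x) zero    = a
(a ∷ₛ x) (suc i) = x i

sumUpTo : (ℕ → ℕ) → ℕ → ℕ
sumUpTo f zero    = f zero
sumUpTo f (suc n) = f (suc n) + sumUpTo f n

≤-sumUpTo : ∀ f {k n} → k ≤ n → f k ≤ sumUpTo f n
≤-sumUpTo f {k} {n} k≤n with ℕ.m≤n⇒m<n∨m≡n k≤n
≤-sumUpTo f {_} {zero}  _ | inj₂ refl = ℕ.≤-refl
≤-sumUpTo f {_} {suc n} _ | inj₂ refl = ℕ.m≤m+n (f (suc n)) _
≤-sumUpTo f {k} {suc n} _ | inj₁ (s≤s k≤n) = ℕ.≤-trans (≤-sumUpTo f k≤n) (ℕ.m≤n+m _ (f (suc n)))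

n≤2^n : ∀ n → n ≤ 2 ^ n
n≤2^n zero    = z≤n
n≤2^n (suc n) = ℕ.+-mono-≤ (ℕ.m^n>0 2 n) (ℕ.≤-trans (n≤2^n n) (ℕ.m≤m+n _ 0))

-- With `n` forests and one bipartite remainder, `2 ^ suc n` colours are used, which has to be less
-- than `k`; the upper bound on `k` allows `f k` to be bounded in terms of `n`.
dyadic : ∀ {k} → 3 ≤ k → ∃[ n ] (2 ^ suc n < k × k ≤ 2 ^ suc (suc n))
dyadic {k} 3≤k with crossing {λ e → k ≤ 2 ^ e} (λ e → k ℕ.≤? 2 ^ e)
                      (ℕ.<⇒≱ (ℕ.<-trans (s≤s (s≤s z≤n)) 3≤k)) {k} (n≤2^n k)
... | zero  , _ , _  , k≤2 = contradiction k≤2 (ℕ.<⇒≱ 3≤k)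
... | suc n , _ , k≰ , k≤  = n , ℕ.≰⇒> k≰ , k≤

-- Classical choice and finite chromatic numbers

module FiniteColourings (classical : Classical) where
  open Classical classical

  abstract
    byContradiction : ∀ {ℓ} {P : Set ℓ} → ¬ ¬ P → P
    byContradiction {P = P} ¬¬P with excludedMiddle {P = P}
    ... | yes p = p
    ... | no ¬p = contradiction ¬p ¬¬P

  notAll : ∀ {a ℓ} {A : Set a} {P : Pred A ℓ} → ¬ (∀ x → P x) → ∃[ x ] ¬ P x
  notAll ¬all = byContradiction λ none → ¬all λ x → byContradiction λ ¬Px → none (x , ¬Px)

  abstract
    least : ∀ {A : Set} {_⊏_ : Rel A 0ℓ} → WellFounded _⊏_ → ∀ {P : Pred A 0ℓ} → ∃ P →
            ∃[ x ] (P x × (∀ y → P y → ¬ y ⊏ x))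
    least {A} {_⊏_} wf {P} (x , Px) = go x (wf x) Px
      where
      go : ∀ x → Acc _⊏_ x → P x → ∃[ x ] (P x × (∀ y → P y → ¬ y ⊏ x))
      go x (acc rs) Px with excludedMiddle {P = ∃[ y ] (P y × y ⊏ x)}
      ... | yes (y , Py , y⊏x) = go y (rs y⊏x) Py
      ... | no none            = x , Px , λ y Py y⊏x → none (y , Py , y⊏x)

  module Enumeration {P : Pred ℕ 0ℓ} (infinite : ∀ m → ∃[ n ] (m ≤ n × P n)) where

    next : ℕ → ℕ
    next m = proj₁ (least <-wellFounded (infinite m))

    m≤next : ∀ m → m ≤ next m
    m≤next m = proj₁ (proj₁ (proj₂ (least <-wellFounded (infinite m))))

    index : ℕ → ℕ
    index zero    = next zero
    index (suc k) = next (suc (index k))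

    index-∈ : ∀ k → P (index k)
    index-∈ zero    = proj₂ (proj₁ (proj₂ (least <-wellFounded (infinite zero))))
    index-∈ (suc k) = proj₂ (proj₁ (proj₂ (least <-wellFounded (infinite (suc (index k))))))

    next-least : ∀ m n → m ≤ n → P n → next m ≤ n
    next-least m n m≤n Pn = ℕ.≮⇒≥ (proj₂ (proj₂ (least <-wellFounded (infinite m))) n (m≤n , Pn))

    index-mono : ∀ {k l} → k < l → index k < index l
    index-mono {k} {suc l} (s≤s k≤l) with ℕ.m≤n⇒m<n∨m≡n k≤l
    ... | inj₁ k<l  = ℕ.<-trans (index-mono {k} {l} k<l) (m≤next (suc (index l)))
    ... | inj₂ refl = m≤next (suc (index k))

    n≤index : ∀ n → n ≤ index n
    n≤index zero    = z≤n
    n≤index (suc n) = ℕ.≤-<-trans (n≤index n) (index-mono {n} {suc n} (ℕ.n<1+n n))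

    index-surjective : ∀ {n} → P n → ∃[ k ] index k ≡ n
    index-surjective {n} Pn with n ℕ.<? index 0
    ... | yes n<0 = contradiction (next-least 0 n z≤n Pn) (ℕ.<⇒≱ n<0)
    ... | no ¬n<0 with crossing {λ k → n < index k} (λ k → n ℕ.<? index k) ¬n<0
                         {suc n} (n≤index (suc n))
    ...   | k , _ , n≮k , n<k+1 with ℕ.m≤n⇒m<n∨m≡n (ℕ.≮⇒≥ n≮k)
    ...     | inj₁ k<n  = contradiction (next-least (suc (index k)) n k<n Pn) (ℕ.<⇒≱ n<k+1)
    ...     | inj₂ refl = k , refl

  -- Counts the colours in use when the colour set `C` is arbitrary. Excluded middle decides whether
  -- the first value recurs among the others.
  imageFactorisation : ∀ {C : Set} m (g : Fin m → C) →
    ∃[ t ] Σ[ i ∈ (Fin t → C) ] Σ[ r ∈ (Fin m → Fin t) ]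
      (Injective _≡_ _≡_ i × (∀ x → i (r x) ≡ g x))
  imageFactorisation zero g = 0 , (λ ()) , (λ ()) , (λ { {()} }) , λ ()
  imageFactorisation {C} (suc m) g with imageFactorisation m (g ∘ Fin.suc)
  ... | t , i , r , i-inj , ir with excludedMiddle {P = ∃[ y ] i y ≡ g Fin.zero}
  ...   | yes (y , iy) = t , i , r′ , i-inj , λ { Fin.zero → iy ; (Fin.suc x) → ir x }
    where
    r′ : Fin (suc m) → Fin t
    r′ Fin.zero    = y
    r′ (Fin.suc x) = r x
  ...   | no new = suc t , i′ , r′ , i′-inj , λ { Fin.zero → refl ; (Fin.suc x) → ir x }
    where
    i′ : Fin (suc t) → C
    i′ Fin.zero    = g Fin.zero
    i′ (Fin.suc y) = i y
    r′ : Fin (suc m) → Fin (suc t)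
    r′ Fin.zero    = Fin.zero
    r′ (Fin.suc x) = Fin.suc (r x)
    i′-inj : Injective _≡_ _≡_ i′
    i′-inj {Fin.zero}  {Fin.zero}  _  = refl
    i′-inj {Fin.zero}  {Fin.suc y} eq = contradiction (y , sym eq) new
    i′-inj {Fin.suc x} {Fin.zero}  eq = contradiction (x , eq) new
    i′-inj {Fin.suc x} {Fin.suc y} eq = cong Fin.suc (i-inj eq)

  -- Let `j` be the least number of colours. A colouring in any set `C` uses some `t` colours and so
  -- factors through `Fin t`; thus `j ≤ t`, and `Fin j` embeds in `C`.
  finiteChromaticNumber : ∀ {V : Set} (H : Graph V) {m} → HasOrder H (Fin m) →
    ∀ {k} → Colouring H (Fin k) → ∃[ j ] (j ≤ k × HasChromaticNumber H (Fin j))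
  finiteChromaticNumber {V} H {m} order {k} colouring
    with least <-wellFounded {Colouring H ∘ Fin} (k , colouring)
  ... | j , colouringⱼ , j-least = j , ℕ.≮⇒≥ (j-least k colouring) , colouringⱼ , bound
    where
    open Bijection order using (to; to⁻; injective; surjective)
    from-to : ∀ v → to⁻ (to v) ≡ v
    from-to v = injective (proj₂ (surjective (to v)) refl)
    bound : ChromaticNumber≥ H (Fin j)
    bound C (c , proper) with imageFactorisation m (c ∘ to⁻)
    ... | t , i , r , i-inj , ir = mk↣ {to = λ x → i (inject≤ x j≤t)}
        λ eq → Fin.inject≤-injective j≤t j≤t _ _ (i-inj eq)
      where
      i∘r∘to : ∀ v → i (r (to v)) ≡ c v
      i∘r∘to v = trans (ir (to v)) (cong c (from-to v))
      j≤t : j ≤ t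
      j≤t = ℕ.≮⇒≥ (j-least t (r ∘ to , λ {x} {y} e eq →
              proper e (trans (sym (i∘r∘to x)) (trans (cong i eq) (i∘r∘to y)))))

  -- Pigeonhole: if each of the `q` shifts put some vertex on residue 0, distinct shifts would need
  -- distinct vertices, and there are only `m < q` of these.
  avoidedResidue : ∀ {V : Set} {m q} .{{_ : NonZero q}} → V ⤖ Fin m → m < q → (φ : V → ℕ) →
                   ∃[ t ] (∀ v → (φ v + t) % q ≢ 0)
  avoidedResidue {V} {m} {q} order m<q φ = byContradiction λ none →
    let hit : ∀ (t : Fin q) → ∃[ v ] (φ v + toℕ t) % q ≡ 0
        hit t = byContradiction λ miss → none (toℕ t , λ v eq → miss (v , eq))
    in ℕ.<⇒≱ m<q (Fin.injective⇒≤ {f = λ t → to (proj₁ (hit t))} λ {t} {t′} eq →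
         let zero-t : (φ (proj₁ (hit t′)) + toℕ t) % q ≡ 0
             zero-t = subst (λ v → (φ v + toℕ t) % q ≡ 0) (injective eq) (proj₂ (hit t))
         in Fin.toℕ-injective (ℕ.≤-antisym
              (ℕ.≮⇒≥ (%-shift-unique _ q (Fin.toℕ<n t) (proj₂ (hit t′)) zero-t))
              (ℕ.≮⇒≥ (%-shift-unique _ q (Fin.toℕ<n t′) zero-t (proj₂ (hit t′))))))
    where open Bijection order using (to; injective)

-- Countable ordinals

module CountableOrdinals (classical : Classical) (ω₁ : Omega₁) where
  open Classical classical
  open FiniteColourings classical
  open Omega₁ ω₁ public renaming (Carrier to Ω; _<_ to _≺_)
  open IsStrictTotalOrder isStrictTotalOrder public
    using (compare) renaming (trans to ≺-trans; irrefl to ≺-irrefl; _<?_ to _≺?_)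

  ≺-asym : ∀ {α β} → α ≺ β → ¬ β ≺ α
  ≺-asym α≺β β≺α = ≺-irrefl refl (≺-trans α≺β β≺α)

  ⊀-≺-trans : ∀ {α β γ} → ¬ β ≺ α → β ≺ γ → α ≺ γ
  ⊀-≺-trans {α} {β} β⊀α β≺γ with compare α β
  ... | tri< α≺β _ _  = ≺-trans α≺β β≺γ
  ... | tri≈ _ refl _ = β≺γ
  ... | tri> _ _ β≺α  = contradiction β≺α β⊀α

  ⊀-trans : ∀ {α β γ} → ¬ β ≺ α → ¬ γ ≺ β → ¬ γ ≺ α
  ⊀-trans β⊀α γ⊀β γ≺α = β⊀α (⊀-≺-trans γ⊀β γ≺α)

  least-unique : ∀ {P : Pred Ω 0ℓ} {α β} → P α → P β →
                 (∀ γ → P γ → ¬ γ ≺ α) → (∀ γ → P γ → ¬ γ ≺ β) → α ≡ β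
  least-unique {α = α} {β} Pα Pβ α-least β-least with compare α β
  ... | tri< α≺β _ _ = contradiction α≺β (β-least α Pα)
  ... | tri≈ _ eq _  = eq
  ... | tri> _ _ β≺α = contradiction β≺α (α-least β Pβ)

  abstract
    max : ∀ α β → ∃[ γ ] (¬ γ ≺ α × ¬ γ ≺ β × (γ ≡ α ⊎ γ ≡ β))
    max α β with α ≺? β
    ... | yes α≺β = β , ≺-asym α≺β , ≺-irrefl refl , inj₂ refl
    ... | no α⊀β  = α , ≺-irrefl refl , α⊀β , inj₁ refl

  abstract
    -- If the sequence were unbounded, ω₁ would be the union of countably many segments.
    sequence-bounded : (g : ℕ → Ω) → ∃[ β ] (∀ n → g n ≺ β)
    sequence-bounded g = byContradiction λ unbounded →
      let below : ∀ β → ∃[ n ] ¬ g n ≺ β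
          below β = notAll λ bounds → unbounded (β , bounds)
          stage : Ω → ℕ
          stage β = proj₁ (below β)
      in uncountable (code stage (proj₂ ∘ below) ,
                      λ {α} {β} _ _ → code-injective stage (proj₂ ∘ below) α β)
      where
      module _ (stage : Ω → ℕ) (g⊀ : ∀ β → ¬ g (stage β) ≺ β) where
        -- `zero` is kept for `γ` itself, because a stage only gives that `β` is at most
        -- `g (stage β)`.
        position : Ω → Ω → ℕ
        position γ β with β ≺? γ
        ... | yes _ = suc (proj₁ (countableSegments γ) β)
        ... | no  _ = zero
        position-injective : ∀ γ {α β} → ¬ γ ≺ α → ¬ γ ≺ β → position γ α ≡ position γ β → α ≡ β
        position-injective γ {α} {β} γ⊀α γ⊀β eq with α ≺? γ | β ≺? γ
        ... | yes α≺γ | yes β≺γ = proj₂ (countableSegments γ) α≺γ β≺γ (ℕ.suc-injective eq)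
        ... | no  α⊀γ | no  β⊀γ = trans (at-top γ⊀α α⊀γ) (sym (at-top γ⊀β β⊀γ))
          where
          at-top : ∀ {δ} → ¬ γ ≺ δ → ¬ δ ≺ γ → δ ≡ γ
          at-top {δ} γ⊀δ δ⊀γ with compare δ γ
          ... | tri< δ≺γ _ _ = contradiction δ≺γ δ⊀γ
          ... | tri≈ _ eq _  = eq
          ... | tri> _ _ γ≺δ = contradiction γ≺δ γ⊀δ
        code : Ω → ℕ
        code β = pair (stage β) (position (g (stage β)) β)
        code-injective : ∀ α β → code α ≡ code β → α ≡ β
        code-injective α β eq
          with pair-injective (stage α) (position (g (stage α)) α)
                              (stage β) (position (g (stage β)) β) eq
        ... | same-stage , same-position = position-injective (g (stage α)) (g⊀ α)
                (subst (λ n → ¬ g n ≺ β) (sym same-stage) (g⊀ β))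
                (trans same-position (cong (λ n → position (g n) β) (sym same-stage)))

  inhabitant : Ω
  inhabitant = byContradiction λ empty →
    uncountable ((λ _ → 0) , λ {α} _ _ _ → contradiction α empty)

  abstract
    countable-bounded : ∀ {A : Set} {P : Pred A 0ℓ} → Countable P → (g : A → Ω) →
                        ∃[ β ] (∀ a → P a → g a ≺ β)
    countable-bounded {A} {P} (e , e-inj) g = proj₁ bound , λ a Pa →
      subst (_≺ proj₁ bound) (value-e a Pa) (proj₂ bound (e a))
      where
      value : ℕ → Ω
      value n with excludedMiddle {P = ∃[ a ] (P a × e a ≡ n)}
      ... | yes (a , _) = g a
      ... | no _        = inhabitant
      value-e : ∀ a → P a → value (e a) ≡ g a
      value-e a Pa with excludedMiddle {P = ∃[ b ] (P b × e b ≡ e a)}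
      ... | yes (b , Pb , eq) = cong g (e-inj Pb Pa eq)
      ... | no none           = contradiction (a , Pa , refl) none
      bound : ∃[ β ] (∀ n → value n ≺ β)
      bound = sequence-bounded value

  segment-bounded : (h : Ω → Ω) → ∀ γ → ∃[ β ] (∀ α → α ≺ γ → h α ≺ β)
  segment-bounded h γ = countable-bounded (countableSegments γ) h

  pair-bounded : ∀ α β → ∃[ γ ] (α ≺ γ × β ≺ γ)
  pair-bounded α β with sequence-bounded (α ∷ₛ λ _ → β)
  ... | γ , bound = γ , bound 0 , bound 1

  -- Makes a function given below `α` total, so that the step of a recursion handles no proofs of
  -- `β ≺ α`.
  restrict : {B : Set} → B → Ω → (Ω → B) → Ω → B
  restrict default α f β with β ≺? α
  ... | yes _ = f β
  ... | no  _ = default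

  restrict-≺ : {B : Set} (default : B) {α : Ω} (f : Ω → B) {β : Ω} → β ≺ α →
               restrict default α f β ≡ f β
  restrict-≺ default {α} f {β} β≺α with β ≺? α
  ... | yes _   = refl
  ... | no  β⊀α = contradiction β≺α β⊀α

  abstract
    recursion : {B : Set} (default : B) (step : Ω → (Ω → B) → B) →
                Σ[ f ∈ (Ω → B) ] (∀ α → f α ≡ step α (restrict default α f))
    recursion {B} default step = All.wfRec wellFounded 0ℓ (λ _ → B) step′ , λ α →
      trans (FixPoint.unfold-wfRec wellFounded (λ _ → B) step′ step′-ext)
        (cong (step α) (extensionality (extend≡restrict α _)))
      where
      extend : ∀ α → (∀ {β} → β ≺ α → B) → Ω → B
      extend α f β with β ≺? α
      ... | yes β≺α = f β≺α
      ... | no  _   = default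
      step′ : ∀ α → (∀ {β} → β ≺ α → B) → B
      step′ α f = step α (extend α f)
      step′-ext : ∀ α {f g : ∀ {β} → β ≺ α → B} → (∀ {β} (β≺α : β ≺ α) → f β≺α ≡ g β≺α) →
                  step′ α f ≡ step′ α g
      step′-ext α {f} {g} f≡g = cong (step α) (extensionality extend-≡)
        where
        extend-≡ : ∀ β → extend α f β ≡ extend α g β
        extend-≡ β with β ≺? α
        ... | yes β≺α = f≡g β≺α
        ... | no  _   = refl
      extend≡restrict : ∀ α (f : Ω → B) β → extend α (λ {β} _ → f β) β ≡ restrict default α f β
      extend≡restrict α f β with β ≺? α
      ... | yes _ = refl
      ... | no  _ = refl

  -- The lexicographic product Ω × ℕ embeds in the range of any expansive function.
  module Embedding (next : Ω → Ω) (expansive : ∀ α → α ≺ next α) where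

    below-countable : ∀ α → Countable {Ω × ℕ} (λ p → proj₁ p ≺ α)
    below-countable α with countableSegments α
    ... | e , e-inj = (λ p → pair (e (proj₁ p)) (proj₂ p)) , λ {p} {q} p≺α q≺α eq →
      let eq₁ , eq₂ = pair-injective (e (proj₁ p)) (proj₂ p) (e (proj₁ q)) (proj₂ q) eq
      in cong₂ _,_ (e-inj p≺α q≺α eq₁) eq₂

    iterate : Ω → ℕ → Ω
    iterate α zero    = next α
    iterate α (suc n) = next (iterate α n)

    above : ∀ α (f : Ω → ℕ → Ω) →
            ∃[ β ] (∀ (p : Ω × ℕ) → proj₁ p ≺ α → f (proj₁ p) (proj₂ p) ≺ β)
    above α f = countable-bounded (below-countable α) λ p → f (proj₁ p) (proj₂ p)

    -- The copy of ℕ at `α` starts above a bound of all earlier copies and then iterates `next`. All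
    -- its members are values of `next`, so a choice of `next` with values in a set keeps the
    -- embedding inside that set.
    embedding : Σ[ h ∈ (Ω → ℕ → Ω) ]
                  (∀ α → h α ≡ iterate (proj₁ (above α (restrict (λ _ → inhabitant) α h))))
    embedding = recursion (λ _ → inhabitant) λ α f → iterate (proj₁ (above α f))

    embed : Ω → ℕ → Ω
    embed = proj₁ embedding

    base : Ω → Ω
    base α = proj₁ (above α (restrict (λ _ → inhabitant) α embed))

    embed-≡ : ∀ α n → embed α n ≡ iterate (base α) n
    embed-≡ α n = cong (λ f → f n) (proj₂ embedding α)

    embed-next : ∀ α n → ∃[ β ] embed α n ≡ next β
    embed-next α zero    = _ , embed-≡ α zero
    embed-next α (suc n) = _ , embed-≡ α (suc n)

    embed-≺-base : ∀ {α β} n → α ≺ β → embed α n ≺ base β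
    embed-≺-base {α} {β} n α≺β = subst (λ f → f n ≺ base β)
      (restrict-≺ (λ _ → inhabitant) embed α≺β)
      (proj₂ (above β (restrict (λ _ → inhabitant) β embed)) (α , n) α≺β)

    ≺-iterate : ∀ α n → α ≺ iterate α n
    ≺-iterate α zero    = expansive α
    ≺-iterate α (suc n) = ≺-trans (≺-iterate α n) (expansive _)

    embed-≺ : ∀ {α β} m n → α ≺ β → embed α m ≺ embed β n
    embed-≺ {β = β} m n α≺β = subst (_ ≺_) (sym (embed-≡ β n))
      (≺-trans (embed-≺-base m α≺β) (≺-iterate (base β) n))

    iterate-mono : ∀ α {m n} → m < n → iterate α m ≺ iterate α n
    iterate-mono α {m} {suc n} (s≤s m≤n) with ℕ.m≤n⇒m<n∨m≡n m≤n
    ... | inj₁ m<n  = ≺-trans (iterate-mono α m<n) (expansive _)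
    ... | inj₂ refl = expansive _

    embed-injective : ∀ {α β m n} → embed α m ≡ embed β n → α ≡ β × m ≡ n
    embed-injective {α} {β} {m} {n} eq with compare α β
    ... | tri< α≺β _ _  = contradiction (embed-≺ m n α≺β) (≺-irrefl eq)
    ... | tri> _ _ β≺α  = contradiction (embed-≺ n m β≺α) (≺-irrefl (sym eq))
    ... | tri≈ _ refl _ with ℕ.<-cmp m n
    ...   | tri≈ _ m≡n _ = refl , m≡n
    ...   | tri< m<n _ _ = contradiction (iterate-mono (base α) m<n)
                             (≺-irrefl (trans (sym (embed-≡ α m)) (trans eq (embed-≡ α n))))
    ...   | tri> _ _ n<m = contradiction (iterate-mono (base α) n<m)
                             (≺-irrefl (trans (sym (embed-≡ α n)) (trans (sym eq) (embed-≡ α m))))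

  bounded⇒countable : ∀ {P : Pred Ω 0ℓ} γ → (∀ α → P α → ¬ γ ≺ α) → Countable P
  bounded⇒countable γ bound with pair-bounded γ γ
  ... | γ′ , γ≺γ′ , _ with countableSegments γ′
  ...   | e , e-inj = e , λ Pα Pβ → e-inj (⊀-≺-trans (bound _ Pα) γ≺γ′) (⊀-≺-trans (bound _ Pβ) γ≺γ′)

  -- Bounded sets are countable, so `P` is unbounded and `next` can be chosen with values in `P`.
  uncountable⇒embeds : ∀ {P : Pred Ω 0ℓ} → ¬ Countable P →
                       Σ[ h ∈ (Ω → Ω) ] (Injective _≡_ _≡_ h × (∀ α → P (h α)))
  uncountable⇒embeds {P} uncountable-P =
    (λ α → embed α 0) , (λ eq → proj₁ (embed-injective eq)) , λ α →
      let β , eq = embed-next α 0 in subst P (sym eq) (proj₁ (proj₂ (larger β)))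
    where
    larger : ∀ γ → ∃[ α ] (P α × γ ≺ α)
    larger γ = byContradiction λ none →
      uncountable-P (bounded⇒countable γ λ α Pα γ≺α → none (α , Pα , γ≺α))
    open Embedding (proj₁ ∘ larger) (proj₂ ∘ proj₂ ∘ larger)

  -- The first vertices of the colour classes form a set on which `c` is injective. Were it
  -- countable, numbering it would turn `c` into a colouring by ℕ; hence it is uncountable and
  -- contains a copy of ω₁.
  colouring⇒embeds : ∀ (G : Graph Ω) → ¬ Colouring G ℕ → ChromaticNumber≥ G Ω
  colouring⇒embeds G no-ℕ C (c , proper) = mk↣ {to = c ∘ proj₁ embedding} λ {α} {β} eq →
      proj₁ (proj₂ embedding)
        (c-injective-First (proj₂ (proj₂ embedding) α) (proj₂ (proj₂ embedding) β) eq)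
    where
    First : Ω → Set
    First α = ∀ β → β ≺ α → c β ≢ c α
    c-injective-First : ∀ {α β} → First α → First β → c α ≡ c β → α ≡ β
    c-injective-First {α} {β} first-α first-β eq with compare α β
    ... | tri< α≺β _ _  = contradiction eq (first-β α α≺β)
    ... | tri≈ _ α≡β _  = α≡β
    ... | tri> _ _ β≺α  = contradiction (sym eq) (first-α β β≺α)
    representative : ∀ α → ∃[ β ] (First β × c β ≡ c α)
    representative α with least wellFounded {λ β → c β ≡ c α} (α , refl)
    ... | β , cβ≡cα , β-least = β , (λ γ γ≺β cγ≡cβ → β-least γ (trans cγ≡cβ cβ≡cα) γ≺β) , cβ≡cα
    uncountable-First : ¬ Countable First
    uncountable-First (e , e-inj) = no-ℕ ((λ α → e (proj₁ (representative α))) , λ {α} {β} edge eq →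
      proper edge (trans (sym (proj₂ (proj₂ (representative α))))
        (trans (cong c (e-inj (proj₁ (proj₂ (representative α))) (proj₁ (proj₂ (representative β))) eq))
          (proj₂ (proj₂ (representative β))))))
    embedding : Σ[ h ∈ (Ω → Ω) ] (Injective _≡_ _≡_ h × (∀ α → First (h α)))
    embedding = uncountable⇒embeds uncountable-First

-- Stationary sets and closure points

module ClosurePoints (classical : Classical) (ω₁ : Omega₁) where
  open FiniteColourings classical
  open CountableOrdinals classical ω₁

  -- The first component excludes 0, which is vacuously closed under every `h`.
  ClosedUnder : (Ω → Ω) → Pred Ω 0ℓ
  ClosedUnder h δ = (∃[ γ ] γ ≺ δ) × (∀ β → β ≺ δ → h β ≺ δ)

  -- Equivalent to stationarity; intersecting countably many clubs becomes taking a
  -- pointwise strict upper bound of countably many functions h.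
  MeetsClosurePoints : Pred Ω 0ℓ → Set
  MeetsClosurePoints S = ∀ h → ∃[ δ ] (S δ × ClosedUnder h δ)

  abstract
    closurePoints-closed : ∀ h → Closed ω₁ (ClosedUnder h)
    closurePoints-closed h δ nonzero unbounded = nonzero , λ β β≺δ →
      let α , (_ , h-closed) , β≺α , α≺δ = unbounded β β≺δ in ≺-trans (h-closed β β≺α) α≺δ

    -- The closure point is the supremum of a sequence from `γ` on in which each term exceeds the
    -- values of `h` below the term before it.
    closurePoints-unbounded : ∀ h → Unbounded ω₁ (ClosedUnder h)
    closurePoints-unbounded h γ = limit (least wellFounded {λ δ → ∀ n → b n ≺ δ} (sequence-bounded b))
      where
      step : ∀ β → ∃[ β′ ] (proj₁ (segment-bounded h β) ≺ β′ × β ≺ β′)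
      step β = pair-bounded (proj₁ (segment-bounded h β)) β
      b : ℕ → Ω
      b zero    = γ
      b (suc n) = proj₁ (step (b n))
      limit : ∃[ δ ] ((∀ n → b n ≺ δ) × (∀ α → (∀ n → b n ≺ α) → ¬ α ≺ δ)) →
              ∃[ δ ] (ClosedUnder h δ × γ ≺ δ)
      limit (δ , b≺δ , δ-least) = δ , ((γ , b≺δ 0) , closed) , b≺δ 0
        where
        closed : ∀ α → α ≺ δ → h α ≺ δ
        closed α α≺δ with notAll {P = λ n → b n ≺ α} (λ b≺α → δ-least α b≺α α≺δ)
        ... | n , b⊀α = ≺-trans
          (proj₂ (segment-bounded h (b (suc n))) α (⊀-≺-trans b⊀α (proj₂ (proj₂ (step (b n))))))
          (≺-trans (proj₁ (proj₂ (step (b (suc n))))) (b≺δ (suc (suc n))))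

    stationary⇒meets : ∀ {S} → Stationary ω₁ S → MeetsClosurePoints S
    stationary⇒meets stationary h =
      stationary (ClosedUnder h) (closurePoints-closed h) (closurePoints-unbounded h)

    meets-mono : ∀ {S T} → (∀ δ → S δ → T δ) → MeetsClosurePoints S → MeetsClosurePoints T
    meets-mono S⊆T meets h = let δ , Sδ , closed = meets h in δ , S⊆T δ Sδ , closed

    meets-restrict : ∀ {S} h → MeetsClosurePoints S →
                     MeetsClosurePoints (λ δ → S δ × ClosedUnder h δ)
    meets-restrict h meets h′ with meets (λ β → proj₁ (pair-bounded (h β) (h′ β)))
    ... | δ , Sδ , nonzero , closed = δ ,
      (Sδ , nonzero , λ β β≺δ → ≺-trans (proj₁ (proj₂ (pair-bounded (h β) (h′ β)))) (closed β β≺δ)) ,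
      nonzero , λ β β≺δ → ≺-trans (proj₂ (proj₂ (pair-bounded (h β) (h′ β)))) (closed β β≺δ)

    -- Countable completeness of the nonstationary ideal: if some function excluded each fibre, a
    -- closure point in `S` of a common bound would lie in its own excluded fibre.
    meets-fibre : ∀ {S} (c : Ω → ℕ) → MeetsClosurePoints S →
                  ∃[ m ] MeetsClosurePoints (λ δ → S δ × c δ ≡ m)
    meets-fibre {S} c meets = byContradiction λ none →
      let avoid : ∀ m → ∃[ h ] ¬ (∃[ δ ] ((S δ × c δ ≡ m) × ClosedUnder h δ))
          avoid m = notAll λ meets-m → none (m , meets-m)
          bound : ∀ β → ∃[ γ ] (∀ m → proj₁ (avoid m) β ≺ γ)
          bound β = sequence-bounded λ m → proj₁ (avoid m) β
          δ , Sδ , nonzero , closed = meets (proj₁ ∘ bound)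
      in proj₂ (avoid (c δ))
           (δ , (Sδ , refl) , nonzero , λ β β≺δ → ≺-trans (proj₂ (bound β) (c δ)) (closed β β≺δ))

    meets⇒unbounded : ∀ {S} → MeetsClosurePoints S → ∀ γ → ∃[ δ ] (S δ × γ ≺ δ)
    -- A nonzero closure point of the constant function `γ` lies above `γ`.
    meets⇒unbounded meets γ with meets (λ _ → γ)
    ... | δ , Sδ , (β , β≺δ) , closed = δ , Sδ , closed β β≺δ

-- Interleaved blocks and small bipartite subgraphs

module Interleaving (classical : Classical) (ω₁ : Omega₁) where
  open Classical classical
  open FiniteColourings classical
  open CountableOrdinals classical ω₁

  -- The pattern is `x s ≺ y 0 ≺ x (s + 1) ≺ y 1 ≺ ⋯`: an ordinal located in `y` reappears in `x`
  -- about `s` places later.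
  record Interleaved (s n : ℕ) (x y : ℕ → Ω) : Set where
    field
      monoˡ : ∀ {i j} → i < j → j < s + n → x i ≺ x j
      monoʳ : ∀ {i j} → i < j → j < s + n → y i ≺ y j
      below : ∀ {i} → i < n → x (s + i) ≺ y i
      above : ∀ {i} → suc i < n → y i ≺ x (s + suc i)

  module Bipartite {V : Set} {m : ℕ} (order : V ⤖ Fin m) (s : ℕ) (m≤s : m ≤ s)
                   (D : Rel V 0ℓ) (t : V → ℕ → Ω) where

    -- d bounds the shift along a walk between two vertices of one component; n leaves
    -- room for the positions 0, …, 2d and one more step.
    d n N : ℕ
    d = 2 ^ s * suc s
    n = 3 + (d + d)
    N = s + n

    Mono : Pred V 0ℓ
    Mono v = ∀ {i j} → i < j → j < N → t v i ≺ t v j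

    -- Each block dominates the other after a shift by `a`; such shifts add up along a walk.
    Near : ℕ → Rel V 0ℓ
    Near a u v = Mono u × Mono v × (∀ i → i + a < N → t u i ≺ t v (i + a) × t v i ≺ t u (i + a))

    near-compose : ∀ {a b u v w} → Near a u v → Near b v w → Near (a + b) u w
    near-compose {a} {b} {u} {v} {w} (mono-u , _ , near-uv) (_ , mono-w , near-vw) =
      mono-u , mono-w , λ i lt →
      ≺-trans (proj₁ (near-uv i (ℕ.≤-<-trans (ℕ.+-monoʳ-≤ i (ℕ.m≤m+n a b)) lt)))
        (subst (λ k → t v (i + a) ≺ t w k) (ℕ.+-assoc i a b)
          (proj₁ (near-vw (i + a) (subst (_< N) (sym (ℕ.+-assoc i a b)) lt)))) ,
      ≺-trans (proj₂ (near-vw i (ℕ.≤-<-trans (ℕ.+-monoʳ-≤ i (ℕ.m≤n+m b a)) lt)))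
        (subst (λ k → t v (i + b) ≺ t u k) (swap i)
          (proj₂ (near-uv (i + b) (subst (_< N) (sym (swap i)) lt))))
      where
      swap : ∀ i → i + b + a ≡ i + (a + b)
      swap i = trans (ℕ.+-assoc i b a) (cong (i +_) (ℕ.+-comm b a))

    near-weaken : ∀ {a b u v} → a ≤ b → Near a u v → Near b u v
    near-weaken {a} {b} {u} {v} a≤b near@(mono-u , mono-v , near-uv) with ℕ.m≤n⇒m<n∨m≡n a≤b
    ... | inj₂ refl = near
    ... | inj₁ a<b  = mono-u , mono-v , λ i lt →
      let i+a<N = ℕ.<-trans (ℕ.+-monoʳ-< i a<b) lt
      in ≺-trans (proj₁ (near-uv i i+a<N)) (mono-v (ℕ.+-monoʳ-< i a<b) lt) ,
         ≺-trans (proj₂ (near-uv i i+a<N)) (mono-u (ℕ.+-monoʳ-< i a<b) lt)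

    near-sym : ∀ {a u v} → Near a u v → Near a v u
    near-sym (mono-u , mono-v , near) =
      mono-v , mono-u , λ i lt → proj₂ (near i lt) , proj₁ (near i lt)

    module _ (inter : ∀ {u v} → D u v → Interleaved s n (t u) (t v)) where

      -- Both bounds are read off the pattern: `t u i ≼ t u (s + i) ≺ t v i ≺ t v (i + suc
      -- s)`, and `t v i ≺ t u (s + suc i)`.
      D-near : ∀ {u v} → D u v → Near (suc s) u v
      D-near {u} {v} Duv = monoˡ , monoʳ , λ i lt →
          ≺-trans (⊀-≺-trans (≼-mono i lt) (below (i<n i lt))) (monoʳ (i<i+1+s i) lt) ,
          subst (λ k → t v i ≺ t u k) (1+s i) (above (1+i<n i lt))
        where
        open Interleaved (inter Duv)
        1+s : ∀ i → s + suc i ≡ i + suc s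
        1+s i = trans (ℕ.+-suc s i) (trans (cong suc (ℕ.+-comm s i)) (sym (ℕ.+-suc i s)))
        1+i<n : ∀ i → i + suc s < N → suc i < n
        1+i<n i lt = ℕ.+-cancelˡ-< s (suc i) n (subst (_< N) (sym (1+s i)) lt)
        i<n : ∀ i → i + suc s < N → i < n
        i<n i lt = ℕ.<-trans (ℕ.n<1+n i) (1+i<n i lt)
        i<i+1+s : ∀ i → i < i + suc s
        i<i+1+s i = ℕ.m<m+n i (s≤s z≤n)
        ≼-mono : ∀ i → i + suc s < N → ¬ t u (s + i) ≺ t u i
        ≼-mono i lt ≻ with ℕ.m≤n⇒m<n∨m≡n (ℕ.m≤n+m i s)
        ... | inj₁ i<s+i = ≺-asym ≻ (monoˡ i<s+i (ℕ.+-monoʳ-< s (i<n i lt)))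
        ... | inj₂ i≡s+i = ≺-irrefl (cong (t u) (sym i≡s+i)) ≻

      E : Rel V 0ℓ
      E u v = D u v ⊎ D v u

      E-sym : Symmetric E
      E-sym (inj₁ Duv) = inj₂ Duv
      E-sym (inj₂ Dvu) = inj₁ Dvu

      E-near : ∀ {u v} → E u v → Near (suc s) u v
      E-near (inj₁ Duv) = D-near Duv
      E-near (inj₂ Dvu) = near-sym (D-near Dvu)

      open Bijection order using (to; to⁻; injective; surjective)

      vertices : List V
      vertices = tabulate to⁻

      ∈-vertices : ∀ v → v ∈ vertices
      ∈-vertices v =
        subst (_∈ vertices) (injective (proj₂ (surjective (to v)) refl)) (∈-tabulate⁺ (to v))

      _~_ : Rel V 0ℓ
      _~_ = Reach E vertices

      ~-near : ∀ {u v} → u ~ v → Near d u v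
      ~-near r = near-weaken
        (ℕ.*-monoˡ-≤ (suc s) (ℕ.^-monoʳ-≤ 2 (ℕ.≤-trans (ℕ.≤-reflexive (length-tabulate to⁻)) m≤s)))
        (Reach-near near-compose near-weaken E-near r)

      -- The index `d` leaves room for a shift by `d` in either direction. The least height serves
      -- as the fixed ordinal of the whole component.
      Height : V → Pred Ω 0ℓ
      Height u ρ = ∃[ v ] (u ~ v × ρ ≡ t v d)

      Reference : V → Pred Ω 0ℓ
      Reference u ρ = Height u ρ × (∀ γ → Height u γ → ¬ γ ≺ ρ)

      -- Adjacent vertices reach the same vertices, hence have the same heights.
      reference-unique : ∀ {u v ρ ρ′} → E u v → Reference u ρ → Reference v ρ′ → ρ ≡ ρ′
      reference-unique {u} {v} e (height , ρ-least) (height′ , ρ′-least) =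
        least-unique {Height u} height (move (E-sym e) height′) ρ-least (λ γ → ρ′-least γ ∘ move e)
        where
        move : ∀ {u v γ} → E u v → Height u γ → Height v γ
        move {u} {v} e (w , u~w , eq) =
          w , Reach-trans (∈-vertices u) (Reach-edge vertices (E-sym e)) u~w , eq

      Position : V → Pred ℕ 0ℓ
      Position u q = ∃[ ρ ] (Reference u ρ × q < d + d × ¬ ρ ≺ t u q × ρ ≺ t u (suc q))

      -- The reference is some `t w d` with `u ~ w`, so nearness puts it above `t u 0` and below
      -- `t u (d + d)`.
      position : ∀ {u v} → E u v → ∃ (Position u)
      position {u} {v} e with least wellFounded {Height u} (t v d , v , Reach-edge vertices e , refl)
      ... | ρ , height@(w , u~w , refl) , ρ-least =
        let _ , _ , near = ~-near u~w
            q , q<2d , ρ⊀ , ρ≺ = crossing {λ k → ρ ≺ t u k} (λ k → ρ ≺? t u k)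
              (≺-asym (proj₁ (near 0 (ℕ.≤-<-trans (ℕ.m≤m+n d d) 2d<N)))) {d + d} (proj₂ (near d 2d<N))
        in q , ρ , (height , ρ-least) , q<2d , ρ⊀ , ρ≺
        where
        2d<N : d + d < N
        2d<N = ℕ.≤-trans (s≤s (ℕ.m≤n+m (d + d) 2)) (ℕ.m≤n+m n s)

      -- On isolated vertices φ is 0.
      φ : V → ℕ
      φ v with excludedMiddle {P = ∃ (Position v)}
      ... | yes (q , _) = q
      ... | no _        = 0

      φ-position : ∀ {u v} → E u v → Position u (φ u)
      φ-position {u} e with excludedMiddle {P = ∃ (Position u)}
      ... | yes (_ , pos) = pos
      ... | no none       = contradiction (position e) none

      ≺-persists : ∀ {u v ρ i j} → D u v → ρ ≺ t u i → i ≤ j → j < N → ρ ≺ t u j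
      ≺-persists Duv ρ≺ i≤j j<N with ℕ.m≤n⇒m<n∨m≡n i≤j
      ... | inj₁ i<j  = ≺-trans ρ≺ (Interleaved.monoˡ (inter Duv) i<j j<N)
      ... | inj₂ refl = ρ≺

      -- Both positions locate the same `ρ`, and `t u (s + φ v) ≺ t v (φ v) ≼ ρ ≺ t v (suc (φ v)) ≺
      -- t u (s + suc (suc (φ v)))`.
      φ-step : ∀ {u v} → D u v → φ u ≡ φ v + s ⊎ φ u ≡ φ v + suc s
      φ-step {u} {v} Duv with φ-position (inj₁ Duv) | φ-position (inj₂ Duv)
      ... | ρ , ref , p<2d , ρ⊀u , ρ≺u | ρ′ , ref′ , q<2d , ρ′⊀v , ρ′≺v
        with reference-unique (inj₁ Duv) ref ref′
      ... | refl with ℕ.m≤n⇒m<n∨m≡n lower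
        where
        open Interleaved (inter Duv)
        lower : s + φ v ≤ φ u
        lower = ℕ.≮⇒≥ λ lt → ρ′⊀v (≺-trans
          (≺-persists Duv ρ≺u lt (ℕ.+-monoʳ-< s (ℕ.<-≤-trans q<2d (ℕ.m≤n+m (d + d) 3))))
          (below (ℕ.<-≤-trans q<2d (ℕ.m≤n+m (d + d) 3))))
      ... | inj₂ eq = inj₁ (trans (sym eq) (ℕ.+-comm s (φ v)))
      ... | inj₁ lt = inj₂ (ℕ.≤-antisym (subst (φ u ≤_) 1+s upper)
                        (subst (_≤ φ u) (trans (sym (ℕ.+-suc s (φ v))) 1+s) lt))
        where
        open Interleaved (inter Duv)
        1+s : s + suc (φ v) ≡ φ v + suc s
        1+s = trans (ℕ.+-suc s (φ v)) (trans (cong suc (ℕ.+-comm s (φ v))) (sym (ℕ.+-suc (φ v) s)))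
        upper : φ u ≤ s + suc (φ v)
        upper = ℕ.≮⇒≥ λ lt → ρ⊀u (≺-persists Duv
            (≺-trans ρ′≺v (above (ℕ.<-≤-trans (s≤s (s≤s q<2d)) (ℕ.n≤1+n _))))
            (subst (_≤ φ u) (sym (ℕ.+-suc s (suc (φ v)))) lt)
            (ℕ.<-≤-trans p<2d (ℕ.≤-trans (ℕ.m≤n+m (d + d) 3) (ℕ.m≤n+m n s))))

      abstract
        twoColouring : Σ[ c ∈ (V → Fin 2) ] (∀ {u v} → D u v → c u ≢ c v)
        twoColouring
          -- There are `2s + 1` shifts and at most `s` vertices, so one shift `r` keeps all vertices
          -- off the residue 0.
          with avoidedResidue {q = suc (s + s)} order (s≤s (ℕ.≤-trans m≤s (ℕ.m≤m+n s s))) φ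
        ... | r , avoids = (λ v → arc s ((φ v + r) % suc (s + s))) , λ {u} {v} Duv eq →
            arc-step s (φ v + r) (φ u + r) (avoids v) (avoids u) (shift u v (φ-step Duv)) (sym eq)
          where
          swap : ∀ a b → a + b + r ≡ a + r + b
          swap a b =
            trans (ℕ.+-assoc a b r) (trans (cong (a +_) (ℕ.+-comm b r)) (sym (ℕ.+-assoc a r b)))
          shift : ∀ u v → φ u ≡ φ v + s ⊎ φ u ≡ φ v + suc s →
                  φ u + r ≡ φ v + r + s ⊎ φ u + r ≡ φ v + r + suc s
          shift u v (inj₁ eq) = inj₁ (trans (cong (_+ r) eq) (swap (φ v) s))
          shift u v (inj₂ eq) = inj₂ (trans (cong (_+ r) eq) (swap (φ v) (suc s)))

-- Generic labels

module Labels (classical : Classical) (ω₁ : Omega₁) where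
  open Classical classical
  open FiniteColourings classical
  open CountableOrdinals classical ω₁
  open Interleaving classical ω₁

  Block Label : Set
  Block = ℕ → Ω
  Label = ℕ → Block

  -- An `N`-fold nested quantifier "for unboundedly many"; the entries from index `N` on are merely
  -- existential.
  RichBlock : ℕ → Pred Block 0ℓ → Set
  RichBlock zero    Q = ∃ Q
  RichBlock (suc N) Q = ∀ γ → ∃[ α ] (γ ≺ α × RichBlock N (Q ∘ (α ∷ₛ_)))

  richBlock⇒∃ : ∀ N {Q} → RichBlock N Q → ∃ Q
  richBlock⇒∃ zero    rich = rich
  richBlock⇒∃ (suc N) rich with rich inhabitant
  ... | α , _ , rich′ with richBlock⇒∃ N rich′
  ...   | x , Qx = α ∷ₛ x , Qx

  Increasing : Ω → ℕ → Pred Block 0ℓ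
  Increasing γ zero    x = ⊤
  Increasing γ (suc N) x = γ ≺ x 0 × Increasing (x 0) N (x ∘ suc)

  increasing-weaken : ∀ {γ γ′} → γ ≺ γ′ → ∀ N {x} → Increasing γ′ N x → Increasing γ N x
  increasing-weaken γ≺γ′ zero    _             = tt
  increasing-weaken γ≺γ′ (suc N) (γ′≺x , rest) = ≺-trans γ≺γ′ γ′≺x , rest

  increasing-above : ∀ {γ} N {x} → Increasing γ N x → ∀ {j} → j < N → γ ≺ x j
  increasing-above (suc N) (γ≺x , _)    {zero}  _         = γ≺x
  increasing-above (suc N) (γ≺x , rest) {suc j} (s≤s j<N) =
    ≺-trans γ≺x (increasing-above N rest j<N)

  increasing-mono : ∀ {γ} N {x} → Increasing γ N x → ∀ {i j} → i < j → j < N → x i ≺ x j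
  increasing-mono (suc N) (_ , rest) {zero}  {suc j} _         (s≤s j<N) =
    increasing-above N rest j<N
  increasing-mono (suc N) (_ , rest) {suc i} {suc j} (s≤s i<j) (s≤s j<N) =
    increasing-mono N rest i<j j<N

  Alternating : Ω → ℕ → Rel Block 0ℓ
  Alternating γ zero    x y = ⊤
  Alternating γ (suc n) x y = γ ≺ x 0 × x 0 ≺ y 0 × Alternating (y 0) n (x ∘ suc) (y ∘ suc)

  alternating-weaken : ∀ {γ γ′} → γ ≺ γ′ → ∀ n {x y} → Alternating γ′ n x y → Alternating γ n x y
  alternating-weaken γ≺γ′ zero    _             = tt
  alternating-weaken γ≺γ′ (suc n) (γ′≺x , rest) = ≺-trans γ≺γ′ γ′≺x , rest

  alternating-below : ∀ {γ} n {x y} → Alternating γ n x y → ∀ {i} → i < n → x i ≺ y i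
  alternating-below (suc n) (_ , x≺y , _)  {zero}  _         = x≺y
  alternating-below (suc n) (_ , _ , rest) {suc i} (s≤s i<n) = alternating-below n rest i<n

  alternating-above : ∀ {γ} n {x y} → Alternating γ n x y → ∀ {i} → suc i < n → y i ≺ x (suc i)
  alternating-above (suc (suc n)) (_ , _ , y≺x , _) {zero}  _         = y≺x
  alternating-above (suc n)       (_ , _ , rest)    {suc i} (s≤s i<n) = alternating-above n rest i<n

  -- The elements are picked in increasing order: first s elements of x, then
  -- alternately n elements of x and of y, and finally t elements of y.
  alternate : ∀ s n t γ {Q Q′} → RichBlock (s + n) Q → RichBlock (n + t) Q′ →
              ∃[ x ] ∃[ y ] (Q x × Q′ y × Increasing γ (s + n) x × Increasing γ (n + t) y ×
                             Alternating γ n (x ∘ (s +_)) y)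
  alternate (suc s) n t γ rich rich′ with rich γ
  ... | α , γ≺α , richα with alternate s n t α richα rich′
  ...   | x , y , Qx , Q′y , inc , inc′ , alt =
    α ∷ₛ x , y , Qx , Q′y ,
    (γ≺α , inc) , increasing-weaken γ≺α (n + t) inc′ , alternating-weaken γ≺α n alt
  alternate zero (suc n) t γ rich rich′ with rich γ
  ... | α , γ≺α , richα with rich′ α
  ...   | β , α≺β , richβ with alternate zero n t β richα richβ
  ...     | x , y , Qx , Q′y , inc , inc′ , alt =
    α ∷ₛ x , β ∷ₛ y , Qx , Q′y ,
    (γ≺α , increasing-weaken α≺β n inc) , (≺-trans γ≺α α≺β , inc′) , γ≺α , α≺β , alt
  alternate zero zero (suc t) γ rich rich′ with rich′ γ
  ... | β , γ≺β , richβ with alternate zero zero t β rich richβ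
  ...   | x , y , Qx , Q′y , _ , inc′ , _ = x , β ∷ₛ y , Qx , Q′y , tt , (γ≺β , inc′) , tt
  alternate zero zero zero γ (x , Qx) (y , Q′y) = x , y , Qx , Q′y , tt , tt , tt

  richBlock-interleaved : ∀ s n {Q Q′} → RichBlock (s + n) Q → RichBlock (s + n) Q′ →
                          ∃[ x ] ∃[ y ] (Q x × Q′ y × Interleaved s n x y)
  richBlock-interleaved s n {Q} {Q′} rich rich′
    with alternate s n s inhabitant rich (subst (λ N → RichBlock N Q′) (ℕ.+-comm s n) rich′)
  ... | x , y , Qx , Q′y , inc , inc′ , alt = x , y , Qx , Q′y , record
    { monoˡ = increasing-mono (s + n) inc
    ; monoʳ = λ {_} {j} i<j j<N → increasing-mono (n + s) inc′ i<j (subst (j <_) (ℕ.+-comm s n) j<N)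
    ; below = alternating-below n alt
    ; above = alternating-above n alt
    }

  -- For each `m` there is a barrier above which no first entry leaves `R m` rich. Countably many
  -- barriers have a common bound `β`, which serves as first entry for all `m` at once.
  richBlock-avoid : ∀ N (R : ℕ → Pred Block 0ℓ) → (∀ m → ¬ RichBlock N (R m)) →
                    ∃[ x ] (∀ m → ¬ R m x)
  richBlock-avoid zero    R poor = (λ _ → inhabitant) , λ m Rx → poor m (_ , Rx)
  richBlock-avoid (suc N) R poor = β ∷ₛ proj₁ rest , proj₂ rest
    where
    barrier : ∀ m → ∃[ γ ] ¬ (∃[ α ] (γ ≺ α × RichBlock N (R m ∘ (α ∷ₛ_))))
    barrier m = notAll (poor m)
    β : Ω
    β = proj₁ (sequence-bounded (proj₁ ∘ barrier))
    rest : ∃[ x ] (∀ m → ¬ R m (β ∷ₛ x))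
    rest = richBlock-avoid N (λ m → R m ∘ (β ∷ₛ_)) λ m rich →
      proj₂ (barrier m) (β , proj₂ (sequence-bounded (proj₁ ∘ barrier)) m , rich)

  Rich : ℕ → (s n : ℕ → ℕ) → Pred Label 0ℓ → Set
  Rich zero    s n Q = ∃ Q
  Rich (suc c) s n Q = RichBlock (s 0 + n 0) λ x → Rich c (s ∘ suc) (n ∘ suc) (Q ∘ (x ∷ₛ_))

  abstract
    rich-interleaved : ∀ c s n {Q Q′} → Rich c s n Q → Rich c s n Q′ →
                       ∃[ X ] ∃[ Y ] (Q X × Q′ Y ×
                         (∀ {j} → j < c → Interleaved (s j) (n j) (X j) (Y j)))
    rich-interleaved zero    s n (X , QX) (Y , Q′Y) = X , Y , QX , Q′Y , λ ()
    rich-interleaved (suc c) s n rich rich′ with richBlock-interleaved (s 0) (n 0) rich rich′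
    ... | x , y , richₓ , richᵧ , inter with rich-interleaved c (s ∘ suc) (n ∘ suc) richₓ richᵧ
    ...   | X , Y , QX , Q′Y , inters =
      x ∷ₛ X , y ∷ₛ Y , QX , Q′Y , λ { {zero} _ → inter ; {suc j} (s≤s j<c) → inters j<c }

  -- The state after finitely many blocks of a label have been chosen: `Q` and `depth` describe what
  -- remains to be avoided.
  record Avoidance : Set₁ where
    field
      s n   : ℕ → ℕ
      Q     : ℕ → Pred Label 0ℓ
      depth : ℕ → ℕ
      poor  : ∀ m → ¬ Rich (depth m) s n (Q m)

    Rest : ℕ → Pred Block 0ℓ
    Rest m x = Rich (ℕ.pred (depth m)) (s ∘ suc) (n ∘ suc) (Q m ∘ (x ∷ₛ_))

    poor-Rest : ∀ m → ¬ RichBlock (s 0 + n 0) (Rest m)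
    poor-Rest m with depth m | poor m
    -- At depth `zero` the set `Q m` is already empty and remains so, which is why `ℕ.pred` may stay
    -- at `zero`.
    ... | zero  | ¬∃Q   = λ rich →
      let x , X , QX = richBlock⇒∃ (s 0 + n 0) rich in ¬∃Q (x ∷ₛ X , QX)
    ... | suc _ | ¬rich = ¬rich

    block : Block
    block = proj₁ (richBlock-avoid (s 0 + n 0) Rest poor-Rest)

    next : Avoidance
    next = record
      { s = s ∘ suc ; n = n ∘ suc ; Q = λ m → Q m ∘ (block ∷ₛ_) ; depth = ℕ.pred ∘ depth
      ; poor = proj₂ (richBlock-avoid (s 0 + n 0) Rest poor-Rest) }

  open Avoidance

  avoiding : Avoidance → Label
  avoiding σ zero    = block σ
  avoiding σ (suc j) = avoiding (next σ) j

  avoiding-unfold : ∀ σ → avoiding σ ≡ block σ ∷ₛ avoiding (next σ)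
  avoiding-unfold σ = extensionality λ { zero → refl ; (suc j) → refl }

  -- Every block lowers the depth by one, and at depth `zero` no continuation at all lies in `Q m`.
  avoiding-avoids : ∀ k σ m → depth σ m ≡ k → ¬ Q σ m (avoiding σ)
  avoiding-avoids zero    σ m eq QX =
    poor σ m (subst (λ k → Rich k (s σ) (n σ) (Q σ m)) (sym eq) (avoiding σ , QX))
  avoiding-avoids (suc k) σ m eq QX =
    avoiding-avoids k (next σ) m (cong ℕ.pred eq) (subst (Q σ m) (avoiding-unfold σ) QX)

  -- The depth up to which Q m is rich may be prescribed by m itself, since it is
  -- the infinite label, not any of its initial segments, that determines m.
  abstract
    someRich : ∀ s n (depth : ℕ → ℕ) (Q : ℕ → Pred Label 0ℓ) → (∀ X → ∃[ m ] Q m X) →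
               ∃[ m ] Rich (depth m) s n (Q m)
    someRich s n depth Q total = byContradiction λ none →
      let σ = record { s = s ; n = n ; Q = Q ; depth = depth ; poor = λ m rich → none (m , rich) }
          m , QX = total (avoiding σ)
      in avoiding-avoids (depth m) σ m refl QX

-- The graph

module Construction (classical : Classical) (ω₁ : Omega₁)
                    (A : Omega₁.Carrier ω₁ → Pred (Omega₁.Carrier ω₁) 0ℓ) (F : ℕ → ℕ) where
  open Classical classical
  open FiniteColourings classical
  open CountableOrdinals classical ω₁
  open ClosurePoints classical ω₁
  open Interleaving classical ω₁
  open Labels classical ω₁

  above : Ω → Ω
  above α = proj₁ (pair-bounded α α)

  ≺-above : ∀ α → α ≺ above α
  ≺-above α = proj₁ (proj₂ (pair-bounded α α))

  open Embedding above ≺-above using (embed; embed-injective)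

  -- Bipartite.n for the shift F j.
  width : ℕ → ℕ
  width j = 3 + (2 ^ F j * suc (F j) + 2 ^ F j * suc (F j))

  -- A single set of ordinals has to record a colouring and a label: tag `0` marks colours, tag
  -- `suc j` the entries of block `j`.
  colourCode : Ω → ℕ → Ω
  colourCode α m = embed α (pair 0 m)

  labelCode : Ω → ℕ → ℕ → Ω
  labelCode α j i = embed α (pair (suc j) i)

  -- If nothing below δ is recorded in A δ, the value is δ.
  label : Ω → Label
  label δ j i with excludedMiddle {P = ∃[ α ] (α ≺ δ × A δ (labelCode α j i))}
  ... | yes (α , _) = α
  ... | no _        = δ

  record Candidate (δ : Ω) (m : ℕ) (α : Ω) : Set where
    field
      smaller    : α ≺ δ
      guessed    : A δ (colourCode α m)
      compatible : ∀ {j} → j < suc m → Interleaved (F j) (width j) (label α j) (label δ j)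

  open Candidate

  -- The premise is there for `δ = 0`, below which a sequence has no possible value.
  Enumerates : (ℕ → Ω) → Ω → Set
  Enumerates g δ = (∃[ γ ] γ ≺ δ → ∀ m → g m ≺ δ) × (∀ γ → γ ≺ δ → ∃[ m ] g m ≡ γ)

  abstract
    enumerate : ∀ δ → ∃[ g ] Enumerates g δ
    enumerate δ with excludedMiddle {P = ∃[ γ ] γ ≺ δ}
    ... | no empty = (λ _ → δ) , (λ nonempty → contradiction nonempty empty) ,
                     (λ γ γ≺δ → contradiction (γ , γ≺δ) empty)
    ... | yes (γ₀ , γ₀≺δ) = (λ m → proj₁ (value m)) , (λ _ m → proj₁ (proj₂ (value m))) ,
                            λ γ γ≺δ → e γ , hits γ γ≺δ
      where
      e : Ω → ℕ
      e = proj₁ (countableSegments δ)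
      value : ∀ m → ∃[ γ ] (γ ≺ δ × (∀ γ′ → γ′ ≺ δ → e γ′ ≡ m → γ ≡ γ′))
      value m with excludedMiddle {P = ∃[ γ ] (γ ≺ δ × e γ ≡ m)}
      ... | yes (γ , γ≺δ , eq) = γ , γ≺δ , λ γ′ γ′≺δ eq′ →
        proj₂ (countableSegments δ) γ≺δ γ′≺δ (trans eq (sym eq′))
      ... | no none            = γ₀ , γ₀≺δ , λ γ′ γ′≺δ eq′ → contradiction (γ′ , γ′≺δ , eq′) none
      hits : ∀ γ → γ ≺ δ → proj₁ (value (e γ)) ≡ γ
      hits γ γ≺δ = proj₂ (proj₂ (value (e γ))) γ γ≺δ refl

  listing : Ω → ℕ → Ω
  listing δ = proj₁ (enumerate δ)

  abstract
    advance : Ω → ℕ → Ω → Ω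
    advance δ m β with excludedMiddle {P = ∃[ α ] (Candidate δ m α × β ≺ α)}
    ... | yes (α , _) = α
    ... | no _        = β

    advance-⊀ : ∀ δ m β → ¬ advance δ m β ≺ β
    advance-⊀ δ m β with excludedMiddle {P = ∃[ α ] (Candidate δ m α × β ≺ α)}
    ... | yes (_ , _ , β≺α) = ≺-asym β≺α
    ... | no _              = ≺-irrefl refl

    advance-≺ : ∀ {δ m β} → β ≺ δ → advance δ m β ≺ δ
    advance-≺ {δ} {m} {β} β≺δ with excludedMiddle {P = ∃[ α ] (Candidate δ m α × β ≺ α)}
    ... | yes (_ , found , _) = smaller found
    ... | no _                = β≺δ

    advance-candidate : ∀ {δ m β} → ∃[ α ] (Candidate δ m α × β ≺ α) →
                        Candidate δ m (advance δ m β) × β ≺ advance δ m β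
    advance-candidate {δ} {m} {β} exists with excludedMiddle {P = ∃[ α ] (Candidate δ m α × β ≺ α)}
    ... | yes (_ , found) = found
    ... | no none         = contradiction exists none

  -- Passing listing δ m at stage m makes the neighbours cofinal in δ.
  mutual
    reached : Ω → ℕ → Ω
    reached δ zero    = listing δ 0
    reached δ (suc m) = advance δ m (barrier δ m)

    barrier : Ω → ℕ → Ω
    barrier δ m = proj₁ (max (reached δ m) (listing δ m))

  -- By `last` there is at most one neighbour of each index. If `advance` finds no candidate there
  -- is none, since `reached δ (suc m)` is then the barrier itself.
  record Neighbour (δ : Ω) (m : ℕ) (α : Ω) : Set where
    constructor neighbour
    field
      candidate : Candidate δ m α
      beyond    : barrier δ m ≺ α
      last      : α ≡ reached δ (suc m)

  open Neighbour

  neighbour-≺ : ∀ {δ m α} → Neighbour δ m α → α ≺ δ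
  neighbour-≺ nb = smaller (candidate nb)

  barrier-⊀-reached : ∀ δ m → ¬ barrier δ m ≺ reached δ m
  barrier-⊀-reached δ m = proj₁ (proj₂ (max (reached δ m) (listing δ m)))

  barrier-⊀-listing : ∀ δ m → ¬ barrier δ m ≺ listing δ m
  barrier-⊀-listing δ m = proj₁ (proj₂ (proj₂ (max (reached δ m) (listing δ m))))

  mutual
    reached-≺ : ∀ {δ} → ∃[ γ ] γ ≺ δ → ∀ m → reached δ m ≺ δ
    reached-≺ {δ} nonzero zero    = proj₁ (proj₂ (enumerate δ)) nonzero 0
    reached-≺     nonzero (suc m) = advance-≺ (barrier-≺ nonzero m)

    barrier-≺ : ∀ {δ} → ∃[ γ ] γ ≺ δ → ∀ m → barrier δ m ≺ δ
    barrier-≺ {δ} nonzero m with proj₂ (proj₂ (proj₂ (max (reached δ m) (listing δ m))))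
    ... | inj₁ eq = subst (_≺ δ) (sym eq) (reached-≺ nonzero m)
    ... | inj₂ eq = subst (_≺ δ) (sym eq) (proj₁ (proj₂ (enumerate δ)) nonzero m)

  neighbour-exists : ∀ {δ m} → ∃[ γ ] γ ≺ δ →
                     (∀ β → β ≺ δ → ∃[ α ] (Candidate δ m α × β ≺ α)) →
                     Neighbour δ m (reached δ (suc m))
  neighbour-exists {δ} {m} nonzero unbounded =
    let found , barrier≺ = advance-candidate (unbounded (barrier δ m) (barrier-≺ nonzero m))
    in neighbour found barrier≺ refl

  reached-mono : ∀ δ {m n} → m ≤ n → ¬ reached δ n ≺ reached δ m
  reached-mono δ {m} {n} m≤n with ℕ.m≤n⇒m<n∨m≡n m≤n
  reached-mono δ {m} {n}     m≤n | inj₂ refl = ≺-irrefl refl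
  reached-mono δ {m} {suc n} _   | inj₁ (s≤s m≤n) =
    ⊀-trans (reached-mono δ m≤n) (⊀-trans (barrier-⊀-reached δ n) (advance-⊀ δ n (barrier δ n)))

  reached-≺-neighbour : ∀ {δ m n α} → m ≤ n → Neighbour δ n α → reached δ m ≺ α
  reached-≺-neighbour {δ} {m} {n} m≤n nb =
    ⊀-≺-trans (reached-mono δ m≤n) (⊀-≺-trans (barrier-⊀-reached δ n) (beyond nb))

  listing-≺-neighbour : ∀ {δ m n α} → m ≤ n → Neighbour δ n α → listing δ m ≺ α
  listing-≺-neighbour {δ} {m} {n} m≤n nb with ℕ.m≤n⇒m<n∨m≡n m≤n
  ... | inj₂ refl = ⊀-≺-trans (barrier-⊀-listing δ m) (beyond nb)
  ... | inj₁ m<n  = ⊀-≺-trans (⊀-trans (barrier-⊀-listing δ m) (advance-⊀ δ m (barrier δ m)))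
                      (reached-≺-neighbour m<n nb)

  graph : Graph Ω
  graph = record
    { Edge   = λ α β → (∃[ m ] Neighbour β m α) ⊎ (∃[ m ] Neighbour α m β)
    ; sym    = λ { (inj₁ e) → inj₂ e ; (inj₂ e) → inj₁ e }
    ; irrefl = λ { refl (inj₁ (_ , nb)) → ≺-irrefl refl (neighbour-≺ nb)
                 ; refl (inj₂ (_ , nb)) → ≺-irrefl refl (neighbour-≺ nb) }
    }

  -- Each index contributes at most one neighbour. If infinitely many indices do, the neighbours
  -- increase with the index, and from index `m` on they exceed `listing β m`; as every ordinal
  -- below `β` is listed, they are cofinal.
  hajnalMáté : HajnalMáté ω₁ graph
  hajnalMáté β with excludedMiddle {P = ∀ m → ∃[ n ] (m ≤ n × ∃ (Neighbour β n))}
  ... | no ¬infinite = inj₁ (applyUpTo (reached β ∘ suc) M , listed)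
    where
    finite : ∃[ M ] ¬ (∃[ n ] (M ≤ n × ∃ (Neighbour β n)))
    finite = notAll ¬infinite
    M : ℕ
    M = proj₁ finite
    listed : ∀ α → α ≺ β × Graph.Edge graph α β → α ∈ applyUpTo (reached β ∘ suc) M
    listed α (α≺β , inj₂ (_ , nb)) = contradiction (neighbour-≺ nb) (≺-asym α≺β)
    listed α (α≺β , inj₁ (m , nb)) with m ℕ.<? M
    ... | yes m<M = subst (_∈ applyUpTo (reached β ∘ suc) M) (sym (last nb))
                      (∈-applyUpTo⁺ (reached β ∘ suc) m<M)
    ... | no m≮M  = contradiction (m , ℕ.≮⇒≥ m≮M , α , nb) (proj₂ finite)
  ... | yes infinite = inj₂ ((s , s-mono , λ α → mk⇔ (to α) (from α)) , unbounded)
    where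
    open Enumeration infinite
    s : ℕ → Ω
    s k = reached β (suc (index k))
    s-neighbour : ∀ k → Neighbour β (index k) (s k)
    s-neighbour k with index-∈ k
    ... | α , nb = subst (Neighbour β (index k)) (last nb) nb
    s-mono : ∀ {m n} → m < n → s m ≺ s n
    s-mono {m} {n} m<n = reached-≺-neighbour (index-mono m<n) (s-neighbour n)
    to : ∀ α → α ≺ β × Graph.Edge graph α β → ∃[ n ] s n ≡ α
    to α (α≺β , inj₂ (_ , nb)) = contradiction (neighbour-≺ nb) (≺-asym α≺β)
    to α (α≺β , inj₁ (m , nb)) with index-surjective (α , nb)
    ... | k , eq = k , trans (cong (reached β ∘ suc) eq) (sym (last nb))
    from : ∀ α → ∃[ n ] s n ≡ α → α ≺ β × Graph.Edge graph α β
    from α (k , refl) = neighbour-≺ (s-neighbour k) , inj₁ (index k , s-neighbour k)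
    unbounded : UnboundedIn ω₁ β (λ α → α ≺ β × Graph.Edge graph α β)
    unbounded γ γ≺β with proj₂ (proj₂ (enumerate β)) γ γ≺β
    ... | m , refl with infinite m
    ...   | n , m≤n , α , nb =
      α , (neighbour-≺ nb , inj₁ (n , nb)) , listing-≺-neighbour m≤n nb , neighbour-≺ nb

  -- Monochromatic edges in countable colourings

  GuessesAll : Set₁
  GuessesAll = ∀ X → Stationary ω₁ (λ α → (X ∩ (_≺ α)) ≐ A α)

  module _ (guesses : GuessesAll) (c : Ω → ℕ) where

    coded : Label → Pred Ω 0ℓ
    coded X γ = (∃[ α ] γ ≡ colourCode α (c α)) ⊎ (∃[ j ] ∃[ i ] γ ≡ labelCode (X j i) j i)

    Correct : Label → Pred Ω 0ℓ
    Correct X δ = (∀ α → α ≺ δ → A δ (colourCode α (c α))) ×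
                  (∀ α m → A δ (colourCode α m) → c α ≡ m) ×
                  label δ ≡ X

    abstract
      -- At closure points of `h` the codes of smaller ordinals are smaller than `δ`, and so are all
      -- the countably many entries of `X`. A correct guess of `coded X` below `δ` therefore decodes
      -- to `c` below `δ` and to the whole of `X`.
      correct-meets : ∀ X → MeetsClosurePoints (Correct X)
      correct-meets X = meets-mono correct (meets-restrict h (stationary⇒meets (guesses (coded X))))
        where
        codes-bounded : ∀ β → ∃[ γ ] (∀ m → embed β m ≺ γ)
        codes-bounded β = sequence-bounded (embed β)
        label-bounded : ∃[ γ ] (∀ p → U p → X (proj₁ p) (proj₂ p) ≺ γ)
        label-bounded = countable-bounded
          ((λ (p : ℕ × ℕ) → pair (proj₁ p) (proj₂ p)) , λ {p} {q} _ _ eq →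
            let eq₁ , eq₂ = pair-injective (proj₁ p) (proj₂ p) (proj₁ q) (proj₂ q) eq
            in cong₂ _,_ eq₁ eq₂)
          (λ p → X (proj₁ p) (proj₂ p))
        both : ∀ β → ∃[ γ ] (proj₁ (codes-bounded β) ≺ γ × proj₁ label-bounded ≺ γ)
        both β = pair-bounded _ _
        h : Ω → Ω
        h = proj₁ ∘ both
        correct : ∀ δ → (coded X ∩ (_≺ δ)) ≐ A δ × ClosedUnder h δ → Correct X δ
        correct δ ((coded⊆A , A⊆coded) , (β , β≺δ) , closed) =
            (λ α α≺δ → coded⊆A (inj₁ (α , refl) , code≺δ α≺δ (pair 0 (c α)))) ,
            colour-correct ,
            extensionality λ j → extensionality λ i → label-correct j i
          where
          code≺δ : ∀ {α} → α ≺ δ → ∀ m → embed α m ≺ δ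
          code≺δ {α} α≺δ m =
            ≺-trans (proj₂ (codes-bounded α) m) (≺-trans (proj₁ (proj₂ (both α))) (closed α α≺δ))
          X≺δ : ∀ j i → X j i ≺ δ
          X≺δ j i =
            ≺-trans (proj₂ label-bounded (j , i) _) (≺-trans (proj₂ (proj₂ (both β))) (closed β β≺δ))
          colour-correct : ∀ α m → A δ (colourCode α m) → c α ≡ m
          colour-correct α m Aδ with proj₁ (A⊆coded Aδ)
          ... | inj₁ (α′ , eq) with embed-injective eq
          ...   | refl , eq′ = sym (proj₂ (pair-injective 0 m 0 (c α) eq′))
          colour-correct α m Aδ | inj₂ (j , i , eq) with embed-injective eq
          ...   | _ , eq′ = contradiction (proj₁ (pair-injective 0 m (suc j) i eq′)) λ ()
          label-correct : ∀ j i → label δ j i ≡ X j i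
          label-correct j i with excludedMiddle {P = ∃[ α ] (α ≺ δ × A δ (labelCode α j i))}
          ... | no none = contradiction
                  (X j i , X≺δ j i , coded⊆A (inj₂ (j , i , refl) , code≺δ (X≺δ j i) _)) none
          ... | yes (α , _ , Aδ) with proj₁ (A⊆coded Aδ)
          ...   | inj₁ (α′ , eq) with embed-injective eq
          ...     | _ , eq′ = contradiction (proj₁ (pair-injective (suc j) i 0 (c α′) eq′)) λ ()
          label-correct j i | yes (α , _ , Aδ) | inj₂ (j′ , i′ , eq) with embed-injective eq
          ...     | α≡X , eq′ with pair-injective (suc j) i (suc j′) i′ eq′
          ...       | refl , refl = α≡X

    Frequent : ℕ → Pred Label 0ℓ
    Frequent m X = MeetsClosurePoints (λ δ → Correct X δ × c δ ≡ m)

    not-proper : ∃[ α ] ∃[ β ] (Graph.Edge graph α β × c α ≡ c β)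
    -- The depth `suc` matches `compatible`: an edge of index `m` compares the blocks `0` to `m`.
    not-proper with someRich F width suc Frequent (λ X → meets-fibre c (correct-meets X))
    ... | m , rich with rich-interleaved (suc m) F width {Frequent m} {Frequent m} rich rich
    -- The function takes each ordinal to a larger one of colour `m` labelled `X`; `δ` is closed
    -- under it and hence a limit of such vertices.
    ... | X , Y , meets-X , meets-Y , inter with meets-Y (proj₁ ∘ meets⇒unbounded meets-X)
    ... | δ , ((recorded , decoded , refl) , cδ≡m) , nonzero , closed =
        reached δ (suc m) , δ , inj₁ (m , found) ,
        -- The neighbour found need not be labelled `X`, but `A δ` records colour `m` for it, and
        -- the guess at `δ` is correct.
        trans (decoded (reached δ (suc m)) m (guessed (candidate found))) (sym cδ≡m)
      where
      candidates : ∀ β → β ≺ δ → ∃[ α ] (Candidate δ m α × β ≺ α)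
      candidates β β≺δ with meets⇒unbounded meets-X β | closed β β≺δ
      ... | α , ((_ , _ , refl) , cα≡m) , β≺α | α≺δ =
        α , record
          { smaller    = α≺δ
          ; guessed    = subst (A δ ∘ colourCode α) cα≡m (recorded α α≺δ)
          ; compatible = inter
          } , β≺α
      found : Neighbour δ m (reached δ (suc m))
      found = neighbour-exists nonzero candidates

  -- Colouring small subgraphs

  flip : Fin 2 → Fin 2
  flip Fin.zero    = Fin.suc Fin.zero
  flip (Fin.suc _) = Fin.zero

  flip-≢ : ∀ x → x ≢ flip x
  flip-≢ Fin.zero           ()
  flip-≢ (Fin.suc Fin.zero) ()

  abstract
    -- The edges of a single index form a forest.
    forestColouring : ∀ m → Σ[ c ∈ (Ω → Fin 2) ] (∀ {α β} → Neighbour β m α → c α ≢ c β)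
    forestColouring m = proj₁ solution , λ {α} {β} → proper α β
      where
      step : Ω → (Ω → Fin 2) → Fin 2
      step β f with excludedMiddle {P = ∃ (Neighbour β m)}
      ... | yes (α , _) = flip (f α)
      ... | no _        = Fin.zero
      solution : Σ[ c ∈ (Ω → Fin 2) ] (∀ α → c α ≡ step α (restrict Fin.zero α c))
      solution = recursion Fin.zero step
      step-neighbour : ∀ f {α β} → Neighbour β m α → step β f ≡ flip (f α)
      step-neighbour f {α} {β} nb with excludedMiddle {P = ∃ (Neighbour β m)}
      ... | yes (_ , nb′) = cong (flip ∘ f) (trans (last nb′) (sym (last nb)))
      ... | no none       = contradiction (α , nb) none
      proper : ∀ α β → Neighbour β m α → proj₁ solution α ≢ proj₁ solution β
      proper α β nb eq = flip-≢ (proj₁ solution α) (trans eq (trans (proj₂ solution β)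
        (trans (step-neighbour (restrict Fin.zero β (proj₁ solution)) nb)
          (cong flip (restrict-≺ Fin.zero (proj₁ solution) (neighbour-≺ nb))))))

    lowColouring : ∀ n → Σ[ c ∈ (Ω → Fin (2 ^ n)) ]
                           (∀ {m α β} → m < n → Neighbour β m α → c α ≢ c β)
    lowColouring zero    = (λ _ → Fin.zero) , λ ()
    lowColouring (suc n) with lowColouring n | forestColouring n
    ... | c , c-proper | c′ , c′-proper =
        (λ α → combine (c′ α) (c α)) , λ {m} {α} {β} → proper {m} {α} {β}
      where
      proper : ∀ {m α β} → m < suc n → Neighbour β m α →
               combine (c′ α) (c α) ≢ combine (c′ β) (c β)
      proper {m} {α} {β} (s≤s m≤n) nb eq
        with Fin.combine-injective (c′ α) (c α) (c′ β) (c β) eq | ℕ.m≤n⇒m<n∨m≡n m≤n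
      ... | _   , eq₂ | inj₁ m<n  = c-proper m<n nb eq₂
      ... | eq₁ , _   | inj₂ refl = c′-proper nb eq₁

  smallSubgraph : ∀ {V : Set} (H : Graph V) → H ⊑ graph → ∀ {m} → HasOrder H (Fin m) →
                  ∀ n → m ≤ F n → Colouring H (Fin (2 ^ suc n))
  smallSubgraph {V} H H⊑G order n m≤F with lowColouring n
  ... | low , low-proper = (λ v → combine (high v) (low (to v))) , proper
    where
    open _⊑_ H⊑G
    to : V → Ω
    to = Injection.to vertices
    D : Rel V 0ℓ
    D u v = ∃[ k ] (n ≤ k × Neighbour (to v) k (to u))
    blocks : V → Block
    blocks v = label (to v) n
    open Bipartite order (F n) m≤F D blocks using (twoColouring)
    highColouring : Σ[ c ∈ (V → Fin 2) ] (∀ {u v} → D u v → c u ≢ c v)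
    -- An edge of index `k ≥ n` interleaves in particular the blocks `n`, with shift `F n`, and
    -- there are at most `F n` vertices.
    highColouring = twoColouring λ { (_ , n≤k , nb) → compatible (candidate nb) (s≤s n≤k) }
    high : V → Fin 2
    high = proj₁ highColouring
    distinct : ∀ u v k → Neighbour (to v) k (to u) →
               combine (high u) (low (to u)) ≢ combine (high v) (low (to v))
    distinct u v k nb eq
      with Fin.combine-injective (high u) (low (to u)) (high v) (low (to v)) eq | ℕ.≤-<-connex n k
    ... | eq₁ , _   | inj₁ n≤k = proj₂ highColouring (k , n≤k , nb) eq₁
    ... | _   , eq₂ | inj₂ k<n = low-proper k<n nb eq₂
    proper : ∀ {u v} → Graph.Edge H u v →
             combine (high u) (low (to u)) ≢ combine (high v) (low (to v))
    proper {u} {v} e with edges e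
    ... | inj₁ (k , nb) = distinct u v k nb
    ... | inj₂ (k , nb) = distinct v u k nb ∘ sym

theoremB : Classical → (ω₁ : Omega₁) → Diamond ω₁ →
    (f : ℕ → ℕ) →
    Σ[ G ∈ Graph (Omega₁.Carrier ω₁) ]
    HajnalMáté ω₁ G ×
    HasOrder G (Omega₁.Carrier ω₁) ×
    HasChromaticNumber G (Omega₁.Carrier ω₁) ×
    (∀ (k : ℕ) → 3 ≤ k →
    (∀ (m : ℕ) → Isf G k m → f k ≤ m) ×
    (∀ (V : Set) (H : Graph V) → H ⊑ G →
    ∀ (m : ℕ) → HasOrder H (Fin m) → m < f k →
    ∃[ j ] (j < k × HasChromaticNumber H (Fin j))))
theoremB classical ω₁ (A , _ , guesses) f =
  graph , hajnalMáté , ⤖-id _ ,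
  ((id , λ {α} {β} e α≡β → Graph.irrefl graph α≡β e) , colouring⇒embeds graph no-ℕ) ,
  λ k 3≤k → lower k 3≤k , small k 3≤k
  where
  open FiniteColourings classical
  open CountableOrdinals classical ω₁ using (colouring⇒embeds)
  -- The shift `F n` is at least `f k` for every `k ≤ 2 ^ suc (suc n)`, hence for each `k` to which
  -- `dyadic` assigns `n`.
  open Construction classical ω₁ A (λ n → sumUpTo f (2 ^ suc (suc n)))

  no-ℕ : ¬ Colouring graph ℕ
  no-ℕ (c , proper) = let _ , _ , e , eq = not-proper guesses c in proper e eq

  small : ∀ k → 3 ≤ k → ∀ (V : Set) (H : Graph V) → H ⊑ graph →
          ∀ m → HasOrder H (Fin m) → m < f k → ∃[ j ] (j < k × HasChromaticNumber H (Fin j))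
  small k 3≤k V H H⊑G m order m<fk with dyadic 3≤k
  ... | n , 2^<k , k≤2^ with finiteChromaticNumber H order
          (smallSubgraph H H⊑G order n (ℕ.≤-trans (ℕ.<⇒≤ m<fk) (≤-sumUpTo f k≤2^)))
  ...   | j , j≤ , chromatic = j , ℕ.≤-<-trans j≤ 2^<k , chromatic

  lower : ∀ k → 3 ≤ k → ∀ m → Isf graph k m → f k ≤ m
  lower k 3≤k m ((W , H , H⊑G , order , χ≥k) , _) = ℕ.≮⇒≥ λ m<fk →
    let j , j<k , (colouring , _) = small k 3≤k W H H⊑G m order m<fk
        k↣j = χ≥k (Fin j) colouring
    in ℕ.<⇒≱ j<k (Fin.injective⇒≤ (Injection.injective k↣j))
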